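{- $E^{ce}_{\mathrm{set}}$ is finitarily reducible to $E^{ce}_3$, i.e. $E^{ce}_{\mathrm{set}}\leq_c^{<\omega}E^{ce}_3$, yet $E^{ce}_{\mathrm{set}}$ is not computably reducible to $E^{ce}_3$.
   Context: $W_e$ is the $e$-th c.e. set; for $A\subseteq\omega$, $A^{[n]}=\{x:\langle x,n\rangle\in A\}$ is its $n$-th column under a standard computable pairing function. $i\,E^{ce}_{\mathrm{set}}\,j\iff\{W_i^{[n]}:n\in\omega\}=\{W_j^{[n]}:n\in\omega\}$; $i\,E^{ce}_3\,j\iff$ for every $n$, $W_i^{[n]}\triangle W_j^{[n]}$ is finite. $E\leq_c F$ (computable reducibility) means there is a computable total $g$ with $x\,E\,y\iff g(x)\,F\,g(y)$ for all $x,y$. An $n$-ary reduction from $E$ to $F$ is a computable total $f:\omega\times\omega^n\to\omega$ such that for all $\vec x\in\omega^n$, with $y_i=f(i,\vec x)$, $x_i\,E\,x_j\iff y_i\,F\,y_j$ for all $i<j<n$; $E\leq_c^{<\omega}F$ means there is one computable $f(n,i,\vec x)$ which for each $n$ is an $n$-ary reduction. -}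

module Defs where

open import Data.Nat using (ℕ; zero; suc; _+_; _≤_)
open import Data.Product using (Σ; ∃; _×_; _,_; proj₁; proj₂)
open import Data.Maybe using (Maybe; just; nothing; _>>=_)
open import Data.Fin using (Fin; toℕ) renaming (_<_ to _<ᶠ_)
open import Data.Vec using (Vec; []; _∷_; lookup)
open import Function.Bundles using (_⇔_)
open import Relation.Binary.PropositionalEquality using (_≡_)

-- Standard computable pairing: Cantor pairing ⟨x,y⟩ = T(x+y) + y,
-- with T(k) = k(k+1)/2, and its inverse by enumerating the diagonals.

tri : ℕ → ℕ
tri zero    = zero
tri (suc k) = suc k + tri k

pair : ℕ → ℕ → ℕ
pair x y = tri (x + y) + y

unpair : ℕ → ℕ × ℕ
unpair zero = (0 , 0)
unpair (suc n) with unpair n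
... | (zero  , y) = (suc y , 0)
... | (suc x , y) = (x , suc y)

fst snd : ℕ → ℕ
fst n = proj₁ (unpair n)
snd n = proj₂ (unpair n)

-- A model of computation: (unary, via pairing) μ-recursive functions.

data Code : Set where
  zer suc′ idc lft rgt : Code
  prc comp rec         : Code → Code → Code
  -- prc f g x = ⟨f x, g x⟩ ; comp f g = f ∘ g ;
  -- rec f g ⟨y,0⟩ = f y ; rec f g ⟨y,n+1⟩ = g ⟨y,⟨n, rec f g ⟨y,n⟩⟩⟩
  mu                   : Code → Code
  -- mu f x = least n with f ⟨x,n⟩ = 0 (all earlier values defined)

recLoop : (Code → ℕ → Maybe ℕ) → Code → Code → ℕ → ℕ → Maybe ℕ
recLoop ev f g y zero    = ev f y
recLoop ev f g y (suc n) = recLoop ev f g y n >>= λ v → ev g (pair y (pair n v))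

muLoop : (Code → ℕ → Maybe ℕ) → Code → ℕ → ℕ → ℕ → Maybe ℕ
muLoop ev f x zero    n = nothing
muLoop ev f x (suc b) n = ev f (pair x n) >>= λ where
  zero    → just n
  (suc _) → muLoop ev f x b (suc n)

eval : ℕ → Code → ℕ → Maybe ℕ
eval zero    _          _ = nothing
eval (suc k) zer        x = just 0
eval (suc k) suc′       x = just (suc x)
eval (suc k) idc        x = just x
eval (suc k) lft        x = just (fst x)
eval (suc k) rgt        x = just (snd x)
eval (suc k) (prc f g)  x = eval k f x >>= λ a → eval k g x >>= λ b → just (pair a b)
eval (suc k) (comp f g) x = eval k g x >>= eval k f
eval (suc k) (rec f g)  x = recLoop (eval k) f g (fst x) (snd x)
eval (suc k) (mu f)     x = muLoop (eval k) f x k 0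

-- Gödel numbering of programs (surjective decoding ℕ → Code).
decodeF : ℕ → ℕ → Code
decodeF zero    _ = zer
decodeF (suc f) n with unpair n
... | (0 , a) = zer
... | (1 , a) = suc′
... | (2 , a) = idc
... | (3 , a) = lft
... | (4 , a) = rgt
... | (5 , a) = prc  (decodeF f (fst a)) (decodeF f (snd a))
... | (6 , a) = comp (decodeF f (fst a)) (decodeF f (snd a))
... | (7 , a) = rec  (decodeF f (fst a)) (decodeF f (snd a))
... | (8 , a) = mu   (decodeF f a)
... | (_ , a) = zer

decode : ℕ → Code
decode n = decodeF (suc n) n

_·_↓=_ : ℕ → ℕ → ℕ → Set
e · x ↓= y = ∃ λ k → eval k (decode e) x ≡ just y

_∈W_ : ℕ → ℕ → Set
x ∈W e = ∃ λ y → e · x ↓= y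

col : ℕ → ℕ → ℕ → Set
col e n x = pair x n ∈W e

SameSet : (ℕ → Set) → (ℕ → Set) → Set
SameSet A B = ∀ x → A x ⇔ B x

FiniteDiff : (ℕ → Set) → (ℕ → Set) → Set
FiniteDiff A B = ∃ λ b → ∀ x → b ≤ x → A x ⇔ B x

Eset : ℕ → ℕ → Set
Eset i j = (∀ n → ∃ λ m → SameSet (col i n) (col j m))
         × (∀ m → ∃ λ n → SameSet (col i n) (col j m))

E3 : ℕ → ℕ → Set
E3 i j = ∀ n → FiniteDiff (col i n) (col j n)

Computable : (ℕ → ℕ) → Set
Computable g = ∃ λ e → ∀ x → e · x ↓= g x

ComputablyReducible : (ℕ → ℕ → Set) → (ℕ → ℕ → Set) → Set
ComputablyReducible E F =
  ∃ λ (g : ℕ → ℕ) → Computable g × (∀ x y → E x y ⇔ F (g x) (g y))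

codeVec : ∀ {n} → Vec ℕ n → ℕ
codeVec []       = 0
codeVec (x ∷ xs) = suc (pair x (codeVec xs))

FinitaryReducible : (ℕ → ℕ → Set) → (ℕ → ℕ → Set) → Set
FinitaryReducible E F =
  Σ ((n : ℕ) → ℕ → Vec ℕ n → ℕ) λ f →
    (∃ λ e → ∀ n i (xs : Vec ℕ n) → e · pair n (pair i (codeVec xs)) ↓= f n i xs)
    × (∀ n (xs : Vec ℕ n) (i j : Fin n) → i <ᶠ j →
         E (lookup xs i) (lookup xs j) ⇔ F (f n (toℕ i) xs) (f n (toℕ j) xs))

{-# OPTIONS --safe #-}

-- Reduction. Write a ≤ b when every column of W_a is a column of W_b; this is "for all c, some h bounds matching
-- columns of b for the columns 0,…,c of a", a conjunction over c of Σ₃ conditions. For each c the c-th columns of the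
-- reducts satisfy C_a ⊆* C_b whenever the c-th condition holds for (a,b): a cell of C guessing a set D of indices keeps
-- one element distinguishing D from its complement as long as no small witness h against a ∈ D, b ∉ D fires forever,
-- and otherwise puts everything into all the sets. Conversely, among n indices a single c refutes all failing
-- inclusions, so guessing D = {b : a ≤ b} at this level separates a from every b outside D.
--
-- Irreducibility. Let x list the finite initial segments of ω and y list these together with ω. If g were a reduction,
-- the recursion theorem gives for every k an index z whose columns are those of x, and also ω exactly when the k-th
-- columns of g(z) and g(x) are =* (a Σ₃ event). They must be =*, as otherwise z lists the same sets as x; then z lists
-- the same sets as y, so the k-th columns of g(z) and g(y) are =* as well. Hence g(x) E₃ g(y), although x and y list
-- different families.

module Submission where

open import Defs
open import Level using (0ℓ)
open import Axiom.ExcludedMiddle using (ExcludedMiddle)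
open import Data.Product using (∃; _×_; _,_; proj₁; proj₂)
open import Relation.Nullary using (¬_; Dec; yes; no; contradiction)
open import Data.Nat
open import Data.Nat.Properties
open import Data.Maybe using (Maybe; just; nothing; _>>=_)
open import Data.Maybe.Properties using (just-injective)
open import Data.Sum using (_⊎_; inj₁; inj₂; [_,_]′)
open import Data.Fin using (Fin; zero; suc; toℕ; fromℕ<)
open import Data.Fin.Properties using (toℕ-fromℕ<; toℕ<n)
open import Data.Vec using (Vec; []; _∷_; lookup; tail; tabulate)
open import Data.Vec.Properties using (lookup∘tabulate)
open import Data.List using (List; []; _∷_)
open import Data.Empty using (⊥)
open import Data.Unit using (⊤; tt)
open import Function.Bundles using (_⇔_; mk⇔; Equivalence)
open import Function.Base using (_∘_; id)
open import Relation.Binary.PropositionalEquality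
open Equivalence using (to; from)

-- Pairing

unpair-suc-zero : ∀ n {y} → unpair n ≡ (zero , y) → unpair (suc n) ≡ (suc y , 0)
unpair-suc-zero n eq rewrite eq = refl

unpair-suc-suc : ∀ n {x y} → unpair n ≡ (suc x , y) → unpair (suc n) ≡ (x , suc y)
unpair-suc-suc n eq rewrite eq = refl

-- Diagonal `suc k` begins right after the last point of diagonal `k`, and each further step of
-- `unpair` moves one place along it.
unpair-tri : ∀ k j → j ≤ k → unpair (tri k + j) ≡ (k ∸ j , j)
unpair-tri zero    .0 z≤n = refl
unpair-tri (suc k) zero j≤k =
  trans (cong unpair (trans (+-identityʳ (tri (suc k))) (cong suc (+-comm k (tri k)))))
        (unpair-suc-zero (tri k + k) (trans (unpair-tri k k ≤-refl) (cong (_, k) (n∸n≡0 k))))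
unpair-tri (suc k) (suc j) (s≤s j≤k) =
  trans (cong unpair (+-suc (tri (suc k)) j))
        (unpair-suc-suc (tri (suc k) + j)
          (trans (unpair-tri (suc k) j (m≤n⇒m≤1+n j≤k)) (cong (_, j) (+-∸-assoc 1 j≤k))))

unpair-pair : ∀ x y → unpair (pair x y) ≡ (x , y)
unpair-pair x y rewrite unpair-tri (x + y) y (m≤n+m y x) | m+n∸n≡m x y = refl

fst-pair : ∀ x y → fst (pair x y) ≡ x
fst-pair x y = cong proj₁ (unpair-pair x y)

snd-pair : ∀ x y → snd (pair x y) ≡ y
snd-pair x y = cong proj₂ (unpair-pair x y)

pair-unpair : ∀ n → pair (fst n) (snd n) ≡ n
pair-unpair zero = refl
pair-unpair (suc n) with unpair n | pair-unpair n
... | (zero  , y) | eq rewrite +-identityʳ y | +-identityʳ (y + tri y) =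
  cong suc (trans (+-comm y (tri y)) eq)
... | (suc x , y) | eq rewrite +-suc x y = trans (+-suc _ y) (cong suc eq)

n≤tri : ∀ n → n ≤ tri n
n≤tri zero    = z≤n
n≤tri (suc n) = m≤m+n (suc n) (tri n)

tri-mono-≤ : ∀ {m n} → m ≤ n → tri m ≤ tri n
tri-mono-≤ z≤n       = z≤n
tri-mono-≤ (s≤s m≤n) = s≤s (+-mono-≤ m≤n (tri-mono-≤ m≤n))

pair-mono-≤ : ∀ {a b c d} → a ≤ c → b ≤ d → pair a b ≤ pair c d
pair-mono-≤ a≤c b≤d = +-mono-≤ (tri-mono-≤ (+-mono-≤ a≤c b≤d)) b≤d

m≤pair : ∀ m n → m ≤ pair m n
m≤pair m n = ≤-trans (m≤m+n m n) (≤-trans (n≤tri (m + n)) (m≤m+n _ n))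

n≤pair : ∀ m n → n ≤ pair m n
n≤pair m n = m≤n+m n (tri (m + n))

fst-≤ : ∀ n → fst n ≤ n
fst-≤ n = subst (fst n ≤_) (pair-unpair n) (m≤pair (fst n) (snd n))

snd-≤ : ∀ n → snd n ≤ n
snd-≤ n = subst (snd n ≤_) (pair-unpair n) (n≤pair (fst n) (snd n))

n<pair-suc : ∀ m n → n < pair (suc m) n
n<pair-suc m n = s≤s (m≤n+m n _)

-- The explicit formula for pair duplicates its second argument; hiding it keeps normal forms small.
opaque
  pair° : ℕ → ℕ → ℕ
  pair° = pair

  pair°≡pair : ∀ x y → pair° x y ≡ pair x y
  pair°≡pair x y = refl

  fst-pair° : ∀ x y → fst (pair° x y) ≡ x
  fst-pair° = fst-pair

  snd-pair° : ∀ x y → snd (pair° x y) ≡ y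
  snd-pair° = snd-pair

  m≤pair° : ∀ m n → m ≤ pair° m n
  m≤pair° = m≤pair

  n≤pair° : ∀ m n → n ≤ pair° m n
  n≤pair° = n≤pair

  pair°-unpair : ∀ n → pair° (fst n) (snd n) ≡ n
  pair°-unpair = pair-unpair

-- Gödel numbers

-- One unfolding of decodeF at ⟨t,a⟩: the with-clause over unpair becomes a match on t, and d decodes the subprograms.
decodeP : (ℕ → Code) → ℕ → ℕ → Code
decodeP d 0 a = zer
decodeP d 1 a = suc′
decodeP d 2 a = idc
decodeP d 3 a = lft
decodeP d 4 a = rgt
decodeP d 5 a = prc  (d (fst a)) (d (snd a))
decodeP d 6 a = comp (d (fst a)) (d (snd a))
decodeP d 7 a = rec  (d (fst a)) (d (snd a))
decodeP d 8 a = mu   (d a)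
decodeP d _ a = zer

decodeF-suc : ∀ f n → decodeF (suc f) n ≡ decodeP (decodeF f) (fst n) (snd n)
decodeF-suc f n with unpair n
... | (0 , a) = refl
... | (1 , a) = refl
... | (2 , a) = refl
... | (3 , a) = refl
... | (4 , a) = refl
... | (5 , a) = refl
... | (6 , a) = refl
... | (7 , a) = refl
... | (8 , a) = refl
... | (suc (suc (suc (suc (suc (suc (suc (suc (suc _)))))))) , a) = refl

decodeP-cong : ∀ {d d′} t a → (∀ {m} → m < pair t a → d m ≡ d′ m) → decodeP d t a ≡ decodeP d′ t a
decodeP-cong 0 a eq = refl
decodeP-cong 1 a eq = refl
decodeP-cong 2 a eq = refl
decodeP-cong 3 a eq = refl
decodeP-cong 4 a eq = refl
decodeP-cong 5 a eq = cong₂ prc  (eq (≤-<-trans (fst-≤ a) (n<pair-suc 4 a))) (eq (≤-<-trans (snd-≤ a) (n<pair-suc 4 a)))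
decodeP-cong 6 a eq = cong₂ comp (eq (≤-<-trans (fst-≤ a) (n<pair-suc 5 a))) (eq (≤-<-trans (snd-≤ a) (n<pair-suc 5 a)))
decodeP-cong 7 a eq = cong₂ rec  (eq (≤-<-trans (fst-≤ a) (n<pair-suc 6 a))) (eq (≤-<-trans (snd-≤ a) (n<pair-suc 6 a)))
decodeP-cong 8 a eq = cong mu (eq (n<pair-suc 7 a))
decodeP-cong (suc (suc (suc (suc (suc (suc (suc (suc (suc _))))))))) a eq = refl

-- Subprograms occur only under tags of at least 5, so their numbers are strictly below the number
-- being decoded, and fuel above `n` never runs out.
decodeF-fuel : ∀ f f′ n → n < f → n < f′ → decodeF f n ≡ decodeF f′ n
decodeF-fuel (suc f) (suc f′) n (s≤s n≤f) (s≤s n≤f′)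
  rewrite decodeF-suc f n | decodeF-suc f′ n =
  decodeP-cong (fst n) (snd n) λ {m} m<p →
    let m<n = subst (m <_) (pair-unpair n) m<p in
    decodeF-fuel f f′ m (<-≤-trans m<n n≤f) (<-≤-trans m<n n≤f′)

decode-pair : ∀ t a → decode (pair t a) ≡ decodeP decode t a
decode-pair t a = begin
  decode (pair t a)                                    ≡⟨ decodeF-suc n n ⟩
  decodeP (decodeF n) (fst n) (snd n)                  ≡⟨ cong₂ (decodeP (decodeF n)) (fst-pair t a) (snd-pair t a) ⟩
  decodeP (decodeF n) t a                              ≡⟨ decodeP-cong t a (λ {m} m<n → decodeF-fuel n (suc m) m m<n ≤-refl) ⟩
  decodeP decode t a                                   ∎
  where open ≡-Reasoning
        n = pair t a

opaque
  unfolding pair°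

  decode-pair° : ∀ t a → decode (pair° t a) ≡ decodeP decode t a
  decode-pair° = decode-pair

encode : Code → ℕ
encode zer        = pair° 0 0
encode suc′       = pair° 1 0
encode idc        = pair° 2 0
encode lft        = pair° 3 0
encode rgt        = pair° 4 0
encode (prc f g)  = pair° 5 (pair° (encode f) (encode g))
encode (comp f g) = pair° 6 (pair° (encode f) (encode g))
encode (rec f g)  = pair° 7 (pair° (encode f) (encode g))
encode (mu f)     = pair° 8 (encode f)

decode-pair°₂ : ∀ t a b (C : Code → Code → Code) → (∀ d c → decodeP d t c ≡ C (d (fst c)) (d (snd c))) →
               decode (pair° t (pair° a b)) ≡ C (decode a) (decode b)
decode-pair°₂ t a b C eq =
  trans (decode-pair° t (pair° a b)) (trans (eq decode (pair° a b))
    (cong₂ (λ u v → C (decode u) (decode v)) (fst-pair° a b) (snd-pair° a b)))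

decode-prc : ∀ a b → decode (pair° 5 (pair° a b)) ≡ prc (decode a) (decode b)
decode-prc a b = decode-pair°₂ 5 a b prc λ _ _ → refl

decode-comp : ∀ a b → decode (pair° 6 (pair° a b)) ≡ comp (decode a) (decode b)
decode-comp a b = decode-pair°₂ 6 a b comp λ _ _ → refl

decode-rec : ∀ a b → decode (pair° 7 (pair° a b)) ≡ rec (decode a) (decode b)
decode-rec a b = decode-pair°₂ 7 a b rec λ _ _ → refl

decode-encode : ∀ c → decode (encode c) ≡ c
decode-encode zer  = decode-pair° 0 0
decode-encode suc′ = decode-pair° 1 0
decode-encode idc  = decode-pair° 2 0
decode-encode lft  = decode-pair° 3 0
decode-encode rgt  = decode-pair° 4 0
decode-encode (prc f g)  = trans (decode-prc _ _)  (cong₂ prc (decode-encode f) (decode-encode g))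
decode-encode (comp f g) = trans (decode-comp _ _) (cong₂ comp (decode-encode f) (decode-encode g))
decode-encode (rec f g)  = trans (decode-rec _ _)  (cong₂ rec (decode-encode f) (decode-encode g))
decode-encode (mu f)     = trans (decode-pair° 8 _) (cong mu (decode-encode f))

-- Big-step semantics

-- Derivations carry no fuel, so later proofs can recurse on the computation itself.
-- `MuLoop f x n m` starts at the candidate `n`, which lets failed candidates be peeled off one at a
-- time.
mutual
  data _[_]⇓_ : Code → ℕ → ℕ → Set where
    zer  : ∀ {x} → zer  [ x ]⇓ 0
    suc′ : ∀ {x} → suc′ [ x ]⇓ suc x
    idc  : ∀ {x} → idc  [ x ]⇓ x
    lft  : ∀ {x} → lft  [ x ]⇓ fst x
    rgt  : ∀ {x} → rgt  [ x ]⇓ snd x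
    prc  : ∀ {f g x a b} → f [ x ]⇓ a → g [ x ]⇓ b → prc f g [ x ]⇓ pair° a b
    comp : ∀ {f g x a b} → g [ x ]⇓ a → f [ a ]⇓ b → comp f g [ x ]⇓ b
    rec  : ∀ {f g x v} → RecLoop f g (fst x) (snd x) v → rec f g [ x ]⇓ v
    mu   : ∀ {f x m} → MuLoop f x 0 m → mu f [ x ]⇓ m

  data RecLoop (f g : Code) (y : ℕ) : ℕ → ℕ → Set where
    base : ∀ {v} → f [ y ]⇓ v → RecLoop f g y 0 v
    step : ∀ {n v w} → RecLoop f g y n v → g [ pair° y (pair° n v) ]⇓ w → RecLoop f g y (suc n) w

  data MuLoop (f : Code) (x : ℕ) : ℕ → ℕ → Set where
    stop : ∀ {n} → f [ pair° x n ]⇓ 0 → MuLoop f x n n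
    next : ∀ {n v m} → f [ pair° x n ]⇓ suc v → MuLoop f x (suc n) m → MuLoop f x n m

>>=-inv : ∀ {A B : Set} {y : B} (m : Maybe A) {k : A → Maybe B} → (m >>= k) ≡ just y →
          ∃ λ a → m ≡ just a × k a ≡ just y
>>=-inv (just a) eq = a , refl , eq

>>=-intro : ∀ {A B : Set} {y : B} {m : Maybe A} {k : A → Maybe B} {a} → m ≡ just a → k a ≡ just y →
            (m >>= k) ≡ just y
>>=-intro refl eq = eq

opaque
  unfolding pair°

  mutual
    eval-sound : ∀ k c {x y} → eval k c x ≡ just y → c [ x ]⇓ y
    eval-sound (suc k) zer  refl = zer
    eval-sound (suc k) suc′ refl = suc′
    eval-sound (suc k) idc  refl = idc
    eval-sound (suc k) lft  refl = lft
    eval-sound (suc k) rgt  refl = rgt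
    eval-sound (suc k) (prc f g) {x} eq with >>=-inv (eval k f x) eq
    ... | a , fa , eq′ with >>=-inv (eval k g x) eq′
    ...   | b , gb , refl = prc (eval-sound k f fa) (eval-sound k g gb)
    eval-sound (suc k) (comp f g) {x} eq with >>=-inv (eval k g x) eq
    ... | a , ga , fa = comp (eval-sound k g ga) (eval-sound k f fa)
    eval-sound (suc k) (rec f g) {x} eq = rec (recLoop-sound k f g (snd x) eq)
    eval-sound (suc k) (mu f)    eq = mu (muLoop-sound k f k 0 eq)

    recLoop-sound : ∀ k f g n {y v} → recLoop (eval k) f g y n ≡ just v → RecLoop f g y n v
    recLoop-sound k f g zero        eq = base (eval-sound k f eq)
    recLoop-sound k f g (suc n) {y} eq with >>=-inv (recLoop (eval k) f g y n) eq
    ... | v , rv , gv = step (recLoop-sound k f g n rv) (eval-sound k g gv)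

    muLoop-sound : ∀ k f b n {x m} → muLoop (eval k) f x b n ≡ just m → MuLoop f x n m
    muLoop-sound k f (suc b) n {x} eq with >>=-inv (eval k f (pair° x n)) eq
    ... | zero  , fn , refl = stop (eval-sound k f fn)
    ... | suc v , fn , eq′  = next (eval-sound k f fn) (muLoop-sound k f b (suc n) eq′)

  recLoop-mono : ∀ {ev ev′ : Code → ℕ → Maybe ℕ} → (∀ c {x y} → ev c x ≡ just y → ev′ c x ≡ just y) →
                 ∀ f g n {y v} → recLoop ev f g y n ≡ just v → recLoop ev′ f g y n ≡ just v
  recLoop-mono le f g zero            eq = le f eq
  recLoop-mono {ev} le f g (suc n) {y} eq with >>=-inv (recLoop ev f g y n) eq
  ... | v , rv , gv = >>=-intro (recLoop-mono le f g n rv) (le g gv)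

  muLoop-mono : ∀ {ev ev′ : Code → ℕ → Maybe ℕ} → (∀ c {x y} → ev c x ≡ just y → ev′ c x ≡ just y) →
                ∀ f {b b′} n {x m} → b ≤ b′ → muLoop ev f x b n ≡ just m → muLoop ev′ f x b′ n ≡ just m
  muLoop-mono {ev} le f {suc b} {suc b′} n {x} (s≤s b≤b′) eq with >>=-inv (ev f (pair° x n)) eq
  ... | zero  , fn , refl = >>=-intro (le f fn) refl
  ... | suc v , fn , eq′  = >>=-intro (le f fn) (muLoop-mono le f (suc n) b≤b′ eq′)

  eval-mono : ∀ {k l} → k ≤ l → ∀ c {x y} → eval k c x ≡ just y → eval l c x ≡ just y
  eval-mono (s≤s k≤l) zer  eq = eq
  eval-mono (s≤s k≤l) suc′ eq = eq
  eval-mono (s≤s k≤l) idc  eq = eq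
  eval-mono (s≤s k≤l) lft  eq = eq
  eval-mono (s≤s k≤l) rgt  eq = eq
  eval-mono (s≤s {k} k≤l) (prc f g) {x} eq with >>=-inv (eval k f x) eq
  ... | a , fa , eq′ with >>=-inv (eval k g x) eq′
  ...   | b , gb , eq″ = >>=-intro (eval-mono k≤l f fa) (>>=-intro (eval-mono k≤l g gb) eq″)
  eval-mono (s≤s {k} k≤l) (comp f g) {x} eq with >>=-inv (eval k g x) eq
  ... | a , ga , fa = >>=-intro (eval-mono k≤l g ga) (eval-mono k≤l f fa)
  eval-mono (s≤s k≤l) (rec f g) {x} eq = recLoop-mono (eval-mono k≤l) f g (snd x) eq
  eval-mono (s≤s k≤l) (mu f)        eq = muLoop-mono (eval-mono k≤l) f 0 k≤l eq

  mutual
    eval-complete : ∀ {c x y} → c [ x ]⇓ y → ∃ λ k → eval k c x ≡ just y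
    eval-complete zer  = 1 , refl
    eval-complete suc′ = 1 , refl
    eval-complete idc  = 1 , refl
    eval-complete lft  = 1 , refl
    eval-complete rgt  = 1 , refl
    eval-complete (prc {f} {g} p q) with eval-complete p | eval-complete q
    ... | k , fa | l , gb = suc (k ⊔ l) ,
      >>=-intro (eval-mono (m≤m⊔n k l) f fa) (>>=-intro (eval-mono (m≤n⊔m k l) g gb) refl)
    eval-complete (comp {f} {g} p q) with eval-complete p | eval-complete q
    ... | k , ga | l , fb = suc (k ⊔ l) , >>=-intro (eval-mono (m≤m⊔n k l) g ga) (eval-mono (m≤n⊔m k l) f fb)
    eval-complete (rec p) with recLoop-complete p
    ... | k , eq = suc k , eq
    eval-complete (mu {f} p) with muLoop-complete p
    -- In `mu` the fuel is also the search bound, so it has to dominate both.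
    ... | k , b , eq = suc (k ⊔ b) , muLoop-mono (eval-mono (m≤m⊔n k b)) f 0 (m≤n⊔m k b) eq

    recLoop-complete : ∀ {f g y n v} → RecLoop f g y n v → ∃ λ k → recLoop (eval k) f g y n ≡ just v
    recLoop-complete (base p) = eval-complete p
    recLoop-complete {f} {g} {n = suc n} (step p q) with recLoop-complete p | eval-complete q
    ... | k , rv | l , gw = k ⊔ l ,
      >>=-intro (recLoop-mono (eval-mono (m≤m⊔n k l)) f g n rv) (eval-mono (m≤n⊔m k l) g gw)

    muLoop-complete : ∀ {f x n m} → MuLoop f x n m → ∃ λ k → ∃ λ b → muLoop (eval k) f x b n ≡ just m
    muLoop-complete (stop p) with eval-complete p
    ... | k , eq = k , 1 , >>=-intro eq refl
    muLoop-complete {f} {n = n} (next p q) with eval-complete p | muLoop-complete q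
    ... | k , eq | l , b , eq′ = k ⊔ l , suc b ,
      >>=-intro (eval-mono (m≤m⊔n k l) f eq) (muLoop-mono (eval-mono (m≤n⊔m k l)) f {b} (suc n) ≤-refl eq′)

-- Both derivations are realised at one common fuel, where `eval` is a function.
⇓-deterministic : ∀ {c x y z} → c [ x ]⇓ y → c [ x ]⇓ z → y ≡ z
⇓-deterministic {c} p q with eval-complete p | eval-complete q
... | k , eq | l , eq′ = just-injective (trans (sym (eval-mono (m≤m⊔n k l) c eq)) (eval-mono (m≤n⊔m k l) c eq′))

∈W-⇔ : ∀ {x e} → x ∈W e ⇔ (∃ λ y → decode e [ x ]⇓ y)
∈W-⇔ {e = e} = mk⇔ (λ (y , k , eq) → y , eval-sound k (decode e) eq) (λ (y , p) → y , eval-complete p)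

-- Primitive recursive terms and bounded formulas

natrec : ℕ → (ℕ → ℕ → ℕ) → ℕ → ℕ
natrec a f zero    = a
natrec a f (suc n) = f (natrec a f n) n

pred° : ℕ → ℕ
pred° = natrec 0 (λ _ i → i)

ifzero : ℕ → ℕ → ℕ → ℕ
ifzero zero    a b = a
ifzero (suc _) a b = b

data Tm : ℕ → Set where
  var   : ∀ {n} → Fin n → Tm n
  wk    : ∀ {n} → Tm n → Tm (1 + n)
  lit   : ∀ {n} → ℕ → Tm n
  suc   : ∀ {n} → Tm n → Tm n
  ⟨_,_⟩ : ∀ {n} → Tm n → Tm n → Tm n
  π₁ π₂ : ∀ {n} → Tm n → Tm n
  ifz   : ∀ {n} → Tm n → Tm n → Tm n → Tm n
  -- The body of a recursion sees the accumulator as variable 0 and the counter as variable 1.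
  nrec  : ∀ {n} → Tm n → Tm (2 + n) → Tm n → Tm n
  sub   : ∀ {m n} → Tm m → Vec (Tm n) m → Tm n
  -- Through this constructor the arbitrary computable `g` of the diagonal argument enters a
  -- formula.
  app   : ∀ {n} (c : Code) (f : ℕ → ℕ) → (∀ x → c [ x ]⇓ f x) → Tm n → Tm n

mutual
  ⟦_⟧ : ∀ {n} → Tm n → Vec ℕ n → ℕ
  ⟦ var i ⟧      v = lookup v i
  ⟦ wk t ⟧       v = ⟦ t ⟧ (tail v)
  ⟦ lit k ⟧      v = k
  ⟦ suc t ⟧      v = suc (⟦ t ⟧ v)
  ⟦ ⟨ s , t ⟩ ⟧  v = pair° (⟦ s ⟧ v) (⟦ t ⟧ v)
  ⟦ π₁ t ⟧       v = fst (⟦ t ⟧ v)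
  ⟦ π₂ t ⟧       v = snd (⟦ t ⟧ v)
  ⟦ ifz t a b ⟧  v = ifzero (⟦ t ⟧ v) (⟦ a ⟧ v) (⟦ b ⟧ v)
  ⟦ nrec a s t ⟧ v = natrec (⟦ a ⟧ v) (λ r i → ⟦ s ⟧ (r ∷ i ∷ v)) (⟦ t ⟧ v)
  ⟦ sub t ts ⟧   v = ⟦ t ⟧ (⟦ ts ⟧* v)
  ⟦ app c f _ t ⟧ v = f (⟦ t ⟧ v)

  ⟦_⟧* : ∀ {m n} → Vec (Tm n) m → Vec ℕ n → Vec ℕ m
  ⟦ [] ⟧*     v = []
  ⟦ t ∷ ts ⟧* v = ⟦ t ⟧ v ∷ ⟦ ts ⟧* v

-- The newest variable is the rightmost, as in the arguments passed by rec and mu.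
enc : ∀ {n} → Vec ℕ n → ℕ
enc []      = 0
enc (x ∷ v) = pair° (enc v) x

varCode : ∀ {n} → Fin n → Code
varCode zero    = rgt
varCode (suc i) = comp (varCode i) lft

constCode : ℕ → Code
constCode zero    = zer
constCode (suc k) = comp suc′ (constCode k)

-- Turns the argument ⟨y,⟨n,r⟩⟩ of a recursion step into ⟨⟨y,n⟩,r⟩, which is `enc (r ∷ n ∷ v)` when
-- `y` is `enc v`.
recArgs : Code
recArgs = prc (prc lft (comp lft rgt)) (comp rgt rgt)

mutual
  compile : ∀ {n} → Tm n → Code
  compile (var i)      = varCode i
  compile (wk t)       = comp (compile t) lft
  compile (lit k)      = constCode k
  compile (suc t)      = comp suc′ (compile t)
  compile ⟨ s , t ⟩    = prc (compile s) (compile t)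
  compile (π₁ t)       = comp lft (compile t)
  compile (π₂ t)       = comp rgt (compile t)
  -- A conditional is a recursion on the test whose step ignores counter and accumulator.
  compile (ifz t a b)  = comp (rec (compile a) (comp (compile b) lft)) (prc idc (compile t))
  compile (nrec a s t) =
    comp (rec (compile a) (comp (compile s) recArgs))
         (prc idc (compile t))
  compile (sub t ts)    = comp (compile t) (compile* ts)
  compile (app c _ _ t) = comp c (compile t)

  compile* : ∀ {m n} → Vec (Tm n) m → Code
  compile* []       = zer
  compile* (t ∷ ts) = prc (compile* ts) (compile t)

lft-⇓ : ∀ a b → lft [ pair° a b ]⇓ a
lft-⇓ a b = subst (lft [ pair° a b ]⇓_) (fst-pair° a b) lft

rgt-⇓ : ∀ a b → rgt [ pair° a b ]⇓ b
rgt-⇓ a b = subst (rgt [ pair° a b ]⇓_) (snd-pair° a b) rgt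

varCode-⇓ : ∀ {n} (i : Fin n) v → varCode i [ enc v ]⇓ lookup v i
varCode-⇓ zero    (x ∷ v) = rgt-⇓ (enc v) x
varCode-⇓ (suc i) (x ∷ v) = comp (lft-⇓ (enc v) x) (varCode-⇓ i v)

constCode-⇓ : ∀ k {x} → constCode k [ x ]⇓ k
constCode-⇓ zero    = zer
constCode-⇓ (suc k) = comp (constCode-⇓ k) suc′

rec-⇓ : ∀ {f g y n v} → RecLoop f g y n v → rec f g [ pair° y n ]⇓ v
rec-⇓ {f} {g} {y} {n} {v} p =
  rec (subst₂ (λ y n → RecLoop f g y n v) (sym (fst-pair° y n)) (sym (snd-pair° y n)) p)

recArgs-⇓ : ∀ y n r → recArgs [ pair° y (pair° n r) ]⇓ pair° (pair° y n) r
recArgs-⇓ y n r =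
  prc (prc (lft-⇓ y (pair° n r)) (comp (rgt-⇓ y (pair° n r)) (lft-⇓ n r)))
      (comp (rgt-⇓ y (pair° n r)) (rgt-⇓ n r))

mutual
  compile-⇓ : ∀ {n} (t : Tm n) v → compile t [ enc v ]⇓ ⟦ t ⟧ v
  compile-⇓ (var i)      v = varCode-⇓ i v
  compile-⇓ (wk t) (x ∷ v) = comp (lft-⇓ (enc v) x) (compile-⇓ t v)
  compile-⇓ (lit k)      v = constCode-⇓ k
  compile-⇓ (suc t)      v = comp (compile-⇓ t v) suc′
  compile-⇓ ⟨ s , t ⟩    v = prc (compile-⇓ s v) (compile-⇓ t v)
  compile-⇓ (π₁ t)       v = comp (compile-⇓ t v) lft
  compile-⇓ (π₂ t)       v = comp (compile-⇓ t v) rgt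
  compile-⇓ (ifz t a b)  v = comp (prc idc (compile-⇓ t v)) (rec-⇓ (loop (⟦ t ⟧ v)))
    where
    loop : ∀ n → RecLoop (compile a) (comp (compile b) lft) (enc v) n (ifzero n (⟦ a ⟧ v) (⟦ b ⟧ v))
    loop zero    = base (compile-⇓ a v)
    loop (suc n) = step (loop n) (comp (lft-⇓ (enc v) _) (compile-⇓ b v))
  compile-⇓ (nrec a s t) v = comp (prc idc (compile-⇓ t v)) (rec-⇓ (loop (⟦ t ⟧ v)))
    where
    loop : ∀ n → RecLoop (compile a) (comp (compile s) recArgs)
                         (enc v) n (natrec (⟦ a ⟧ v) (λ r i → ⟦ s ⟧ (r ∷ i ∷ v)) n)
    loop zero    = base (compile-⇓ a v)
    loop (suc n) = step (loop n)
      (comp (recArgs-⇓ (enc v) n _) (compile-⇓ s (_ ∷ n ∷ v)))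
  compile-⇓ (sub t ts)    v = comp (compile*-⇓ ts v) (compile-⇓ t (⟦ ts ⟧* v))
  compile-⇓ (app c f p t) v = comp (compile-⇓ t v) (p _)

  compile*-⇓ : ∀ {m n} (ts : Vec (Tm n) m) v → compile* ts [ enc v ]⇓ enc (⟦ ts ⟧* v)
  compile*-⇓ []       v = zer
  compile*-⇓ (t ∷ ts) v = prc (compile*-⇓ ts v) (compile-⇓ t v)

v₀ : ∀ {n} → Tm (1 + n)
v₀ = var zero
v₁ : ∀ {n} → Tm (2 + n)
v₁ = var (suc zero)
v₂ : ∀ {n} → Tm (3 + n)
v₂ = var (suc (suc zero))
v₃ : ∀ {n} → Tm (4 + n)
v₃ = var (suc (suc (suc zero)))
v₄ : ∀ {n} → Tm (5 + n)
v₄ = var (suc (suc (suc (suc zero))))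
v₅ : ∀ {n} → Tm (6 + n)
v₅ = var (suc (suc (suc (suc (suc zero)))))
v₆ : ∀ {n} → Tm (7 + n)
v₆ = var (suc (suc (suc (suc (suc (suc zero))))))
v₇ : ∀ {n} → Tm (8 + n)
v₇ = var (suc (suc (suc (suc (suc (suc (suc zero)))))))
v₈ : ∀ {n} → Tm (9 + n)
v₈ = var (suc (suc (suc (suc (suc (suc (suc (suc zero))))))))

predT : ∀ {n} → Tm n → Tm n
predT t = nrec (lit 0) v₁ t

-- Bounded formulas, with atoms for already compiled predicates; a compiled formula has value 0 when it holds.
data Fm (n : ℕ) : Set₁ where
  _≐0     : Tm n → Fm n
  _≺_     : Tm n → Tm n → Fm n
  _∧_ _∨_ _⊃_ : Fm n → Fm n → Fm n
  all any : Tm n → Fm (suc n) → Fm n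
  atom    : ∀ {m} (P : Vec ℕ m → Set) (t : Tm m) → (∀ v → ⟦ t ⟧ v ≡ 0 ⇔ P v) → Vec (Tm n) m → Fm n

⟦_⟧ᶠ : ∀ {n} → Fm n → Vec ℕ n → Set
⟦ t ≐0 ⟧ᶠ      v = ⟦ t ⟧ v ≡ 0
⟦ s ≺ t ⟧ᶠ     v = ⟦ s ⟧ v < ⟦ t ⟧ v
⟦ φ ∧ ψ ⟧ᶠ     v = ⟦ φ ⟧ᶠ v × ⟦ ψ ⟧ᶠ v
⟦ φ ∨ ψ ⟧ᶠ     v = ⟦ φ ⟧ᶠ v ⊎ ⟦ ψ ⟧ᶠ v
⟦ φ ⊃ ψ ⟧ᶠ     v = ⟦ φ ⟧ᶠ v → ⟦ ψ ⟧ᶠ v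
⟦ all t φ ⟧ᶠ   v = ∀ i → i < ⟦ t ⟧ v → ⟦ φ ⟧ᶠ (i ∷ v)
⟦ any t φ ⟧ᶠ   v = ∃ λ i → i < ⟦ t ⟧ v × ⟦ φ ⟧ᶠ (i ∷ v)
⟦ atom P _ _ ts ⟧ᶠ v = P (⟦ ts ⟧* v)

toTm : ∀ {n} → Fm n → Tm n
toTm (t ≐0)      = t
-- The value is `suc s ∸ t`, obtained by `t` predecessors.
toTm (s ≺ t)     = nrec (suc s) (predT v₀) t
toTm (φ ∧ ψ)     = ifz (toTm φ) (toTm ψ) (lit 1)
toTm (φ ∨ ψ)     = ifz (toTm φ) (lit 0) (toTm ψ)
toTm (φ ⊃ ψ)     = ifz (toTm φ) (toTm ψ) (lit 0)
-- A counterexample sets the accumulator to 1 for good. `wk` hides the accumulator, so that `φ` sees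
-- the counter as its newest variable.
toTm (all t φ)   = nrec (lit 0) (ifz (wk (toTm φ)) v₀ (lit 1)) t
toTm (any t φ)   = nrec (lit 1) (ifz (wk (toTm φ)) (lit 0) v₀) t
toTm (atom P t _ ts) = sub t ts

pred°≡pred : ∀ n → pred° n ≡ pred n
pred°≡pred zero    = refl
pred°≡pred (suc n) = refl

monus-natrec : ∀ s t → natrec s (λ r _ → pred° r) t ≡ s ∸ t
monus-natrec s zero    = refl
monus-natrec s (suc t) = begin
  pred° (natrec s (λ r _ → pred° r) t) ≡⟨ pred°≡pred (natrec s (λ r _ → pred° r) t) ⟩
  pred (natrec s (λ r _ → pred° r) t)                 ≡⟨ cong pred (monus-natrec s t) ⟩
  pred (s ∸ t)                                                      ≡⟨ pred[m∸n]≡m∸[1+n] s t ⟩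
  s ∸ suc t                                                         ∎
  where open ≡-Reasoning

toTm-correct : ∀ {n} (φ : Fm n) v → ⟦ toTm φ ⟧ v ≡ 0 ⇔ ⟦ φ ⟧ᶠ v
toTm-correct (t ≐0)  v = mk⇔ id id
toTm-correct (s ≺ t) v rewrite monus-natrec (suc (⟦ s ⟧ v)) (⟦ t ⟧ v) = mk⇔ m∸n≡0⇒m≤n m≤n⇒m∸n≡0
toTm-correct (φ ∧ ψ) v with ⟦ toTm φ ⟧ v | toTm-correct φ v | toTm-correct ψ v
... | zero  | p | q = mk⇔ (λ e → to p refl , to q e) (λ (_ , b) → from q b)
... | suc _ | p | q = mk⇔ (λ ()) (λ (a , _) → contradiction (from p a) λ ())
toTm-correct (φ ∨ ψ) v with ⟦ toTm φ ⟧ v | toTm-correct φ v | toTm-correct ψ v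
... | zero  | p | q = mk⇔ (λ _ → inj₁ (to p refl)) (λ _ → refl)
... | suc _ | p | q = mk⇔ (λ e → inj₂ (to q e)) λ where
  (inj₁ a) → contradiction (from p a) λ ()
  (inj₂ b) → from q b
toTm-correct (φ ⊃ ψ) v with ⟦ toTm φ ⟧ v | toTm-correct φ v | toTm-correct ψ v
... | zero  | p | q = mk⇔ (λ e _ → to q e) (λ f → from q (f (to p refl)))
... | suc _ | p | q = mk⇔ (λ _ a → contradiction (from p a) λ ()) (λ _ → refl)
toTm-correct (all t φ) v = go (⟦ t ⟧ v)
  where
  go : ∀ n → natrec 0 (λ r i → ifzero (⟦ toTm φ ⟧ (i ∷ v)) r 1) n ≡ 0 ⇔ (∀ i → i < n → ⟦ φ ⟧ᶠ (i ∷ v))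
  go zero = mk⇔ (λ _ _ ()) (λ _ → refl)
  go (suc n) with ⟦ toTm φ ⟧ (n ∷ v) | toTm-correct φ (n ∷ v)
  ... | zero  | p = mk⇔
    (λ e i i<1+n → [ to (go n) e i , (λ { refl → to p refl }) ]′ (m<1+n⇒m<n∨m≡n i<1+n))
    (λ f → from (go n) λ i i<n → f i (m<n⇒m<1+n i<n))
  ... | suc _ | p = mk⇔ (λ ()) (λ f → contradiction (from p (f n ≤-refl)) λ ())
toTm-correct (any t φ) v = go (⟦ t ⟧ v)
  where
  go : ∀ n → natrec 1 (λ r i → ifzero (⟦ toTm φ ⟧ (i ∷ v)) 0 r) n ≡ 0 ⇔ (∃ λ i → i < n × ⟦ φ ⟧ᶠ (i ∷ v))
  go zero = mk⇔ (λ ()) (λ ())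
  go (suc n) with ⟦ toTm φ ⟧ (n ∷ v) | toTm-correct φ (n ∷ v)
  ... | zero  | p = mk⇔ (λ _ → n , ≤-refl , to p refl) (λ _ → refl)
  ... | suc _ | p = mk⇔
    (λ e → let i , i<n , a = to (go n) e in i , m<n⇒m<1+n i<n , a)
    (λ (i , i<1+n , a) → [ (λ i<n → from (go n) (i , i<n , a))
                         , (λ { refl → contradiction (from p a) λ () }) ]′ (m<1+n⇒m<n∨m≡n i<1+n))
toTm-correct (atom P t p ts) v = p (⟦ ts ⟧* v)

call : ∀ {m n} → Fm m → Vec (Tm n) m → Fm n
call φ = atom ⟦ φ ⟧ᶠ (toTm φ) (toTm-correct φ)

-- Parametrised c.e. sets

-- The s-m-n function: the constant `p` is put in front of the input of program `u`. As a term it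
-- can be evaluated inside programs, which both the recursion theorem and the computability of the
-- reduction require.
smnT : Tm 2
smnT = ⟨ lit 6 , ⟨ v₀ , ⟨ lit 5 , ⟨ constT , lit (encode idc) ⟩ ⟩ ⟩ ⟩
  where
  constT : Tm 2
  constT = nrec (lit (encode zer)) ⟨ lit 6 , ⟨ lit (encode suc′) , v₀ ⟩ ⟩ v₁

smn : ℕ → ℕ → ℕ
smn u p = ⟦ smnT ⟧ (u ∷ p ∷ [])

decode-smn : ∀ u p → decode (smn u p) ≡ comp (decode u) (prc (constCode p) idc)
decode-smn u p = trans (decode-comp u _) (cong (comp (decode u)) (trans (decode-prc _ _)
  (cong₂ prc (constant p) (decode-encode idc))))
  where
  constant : ∀ k → decode (natrec (encode zer) (λ r _ → pair° 6 (pair° (encode suc′) r)) k) ≡ constCode k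
  constant zero    = decode-encode zer
  constant (suc k) = trans (decode-comp (encode suc′) _) (cong₂ comp (decode-encode suc′) (constant k))

search : ∀ {n} → Fm (1 + n) → Code
search φ = mu (compile (toTm φ))

search-⇔ : ∀ {n} (φ : Fm (1 + n)) v → (∃ λ y → search φ [ enc v ]⇓ y) ⇔ (∃ λ t → ⟦ φ ⟧ᶠ (t ∷ v))
search-⇔ φ v = mk⇔ (λ { (_ , mu p) → found p }) λ (t , a) →
  let m , p = least t (subst (λ s → ⟦ φ ⟧ᶠ (s ∷ v)) (sym (+-identityʳ t)) a) in m , mu p
  where
  found : ∀ {n m} → MuLoop (compile (toTm φ)) (enc v) n m → ∃ λ t → ⟦ φ ⟧ᶠ (t ∷ v)
  found (stop {n} p) = n , to (toTm-correct φ (n ∷ v)) (⇓-deterministic (compile-⇓ (toTm φ) (n ∷ v)) p)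
  found (next p q)   = found q
  -- `t` is the distance from the candidate `n` to a known solution, so the search ends.
  least : ∀ {n} t → ⟦ φ ⟧ᶠ (t + n ∷ v) → ∃ λ m → MuLoop (compile (toTm φ)) (enc v) n m
  least {n} t a with ⟦ toTm φ ⟧ (n ∷ v) in eq
  ... | zero = n , stop (subst (compile (toTm φ) [ enc (n ∷ v) ]⇓_) eq (compile-⇓ (toTm φ) (n ∷ v)))
  least {n} zero a | suc _ = contradiction (trans (sym eq) (from (toTm-correct φ (n ∷ v)) a)) λ ()
  least {n} (suc t) a | suc _ =
    let m , p = least t (subst (λ s → ⟦ φ ⟧ᶠ (s ∷ v)) (sym (+-suc t n)) a) in
    m , next (subst (compile (toTm φ) [ enc (n ∷ v) ]⇓_) eq (compile-⇓ (toTm φ) (n ∷ v))) p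

colArgs : Code
colArgs = prc (prc lft (comp rgt rgt)) (comp lft rgt)

indexOf : ∀ {n} → Fm (3 + n) → ℕ
indexOf φ = encode (comp (search φ) colArgs)

-- The program searches for `t` after `colArgs` has rearranged its input into the environment. From
-- here on, c.e. columns are given by formulas alone.
col-smn : ∀ {n} (φ : Fm (3 + n)) v j x →
          col (smn (indexOf φ) (enc v)) j x ⇔ (∃ λ t → ⟦ φ ⟧ᶠ (t ∷ x ∷ j ∷ v))
col-smn φ v j x = mk⇔
  (λ w → let y , p = to W w in
    to (search-⇔ φ (x ∷ j ∷ v)) (y , there (subst (_[ pair x j ]⇓ y) code p)))
  (λ a → let y , p = from (search-⇔ φ (x ∷ j ∷ v)) a in
    from W (y , subst (_[ pair x j ]⇓ y) (sym code) (comp (prc (constCode-⇓ (enc v)) idc) (comp args p))))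
  where
  W = ∈W-⇔ {pair x j} {smn (indexOf φ) (enc v)}
  code : decode (smn (indexOf φ) (enc v)) ≡ comp (comp (search φ) colArgs) (prc (constCode (enc v)) idc)
  code = trans (decode-smn (indexOf φ) (enc v))
    (cong (λ c → comp c (prc (constCode (enc v)) idc)) (decode-encode (comp (search φ) colArgs)))
  args : colArgs [ pair° (enc v) (pair x j) ]⇓ enc (x ∷ j ∷ v)
  args = subst (λ p → colArgs [ pair° (enc v) p ]⇓ enc (x ∷ j ∷ v)) (pair°≡pair x j)
    (prc (prc (lft-⇓ (enc v) _) (comp (rgt-⇓ (enc v) _) (rgt-⇓ x j))) (comp (rgt-⇓ (enc v) _) (lft-⇓ x j)))
  there : ∀ {y} → comp (comp (search φ) colArgs) (prc (constCode (enc v)) idc) [ pair x j ]⇓ y →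
          search φ [ enc (x ∷ j ∷ v) ]⇓ y
  there (comp p (comp q r))
    with ⇓-deterministic p (prc (constCode-⇓ (enc v)) idc)
  ... | refl with ⇓-deterministic q args
  ...   | refl = r

computable : (t : Tm 1) → Computable λ x → ⟦ t ⟧ (x ∷ [])
computable t = encode (comp (compile t) (prc zer idc)) , λ x → eval-complete
  (subst (_[ x ]⇓ ⟦ t ⟧ (x ∷ [])) (sym (decode-encode (comp (compile t) (prc zer idc))))
    (comp (prc zer idc) (compile-⇓ t (x ∷ []))))

-- A universal stack machine

cases : ∀ {n} → Tm n → List (Tm n) → Tm n → Tm n
cases t []       d = d
cases t (b ∷ bs) d = ifz t b (cases (predT t) bs d)

-- The carrier is abstract so that the same frames exist as terms and as numbers. A stack is 0 or
-- the successor of a pair. Tags: 0 a program to run; 1 and 2 a pairing that waits for its first or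
-- second component; 3 a recursion with `m` steps left; 4 a search at candidate `n`.
module Frames {A : Set} (suc′ : A → A) (pair°′ : A → A → A) (lit′ : ℕ → A) where
  push : A → A → A
  push f S = suc′ (pair°′ f S)

  run prc₂ : A → A
  run e  = pair°′ (lit′ 0) e
  prc₂ a = pair°′ (lit′ 2) a

  prc₁ : A → A → A
  prc₁ g x = pair°′ (lit′ 1) (pair°′ g x)

  recF : A → A → A → A → A
  recF g y i m = pair°′ (lit′ 3) (pair°′ g (pair°′ y (pair°′ i m)))

  muF : A → A → A → A
  muF f x n = pair°′ (lit′ 4) (pair°′ f (pair°′ x n))

module Fᵀ {n} = Frames {Tm n} suc ⟨_,_⟩ lit
open Frames {ℕ} suc pair° id

-- Variables: tag and argument of the running program, remaining stack, input.
runT : Tm 4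
runT = cases v₀
  ( ⟨ v₂ , lit 0 ⟩ ∷ ⟨ v₂ , suc v₃ ⟩ ∷ ⟨ v₂ , v₃ ⟩ ∷ ⟨ v₂ , π₁ v₃ ⟩ ∷ ⟨ v₂ , π₂ v₃ ⟩
  ∷ ⟨ Fᵀ.push (Fᵀ.run (π₁ v₁)) (Fᵀ.push (Fᵀ.prc₁ (π₂ v₁) v₃) v₂) , v₃ ⟩
  ∷ ⟨ Fᵀ.push (Fᵀ.run (π₂ v₁)) (Fᵀ.push (Fᵀ.run (π₁ v₁)) v₂) , v₃ ⟩
  ∷ ⟨ Fᵀ.push (Fᵀ.run (π₁ v₁)) (Fᵀ.push (Fᵀ.recF (π₂ v₁) (π₁ v₃) (lit 0) (π₂ v₃)) v₂) , π₁ v₃ ⟩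
  ∷ ⟨ Fᵀ.push (Fᵀ.run v₁) (Fᵀ.push (Fᵀ.muF v₁ v₃ (lit 0)) v₂) , ⟨ v₃ , lit 0 ⟩ ⟩
  ∷ []) ⟨ v₂ , lit 0 ⟩

-- Variables: tag and argument of the top frame, remaining stack, value returned to that frame.
frameT : Tm 4
frameT = cases v₀
  ( sub runT (π₁ v₁ ∷ π₂ v₁ ∷ v₂ ∷ v₃ ∷ [])
  ∷ ⟨ Fᵀ.push (Fᵀ.run (π₁ v₁)) (Fᵀ.push (Fᵀ.prc₂ v₃) v₂) , π₂ v₁ ⟩
  ∷ ⟨ v₂ , ⟨ v₁ , v₃ ⟩ ⟩
  ∷ sub (ifz v₃ ⟨ v₄ , v₅ ⟩
          ⟨ Fᵀ.push (Fᵀ.run v₀) (Fᵀ.push (Fᵀ.recF v₀ v₁ (suc v₂) (predT v₃)) v₄) , ⟨ v₁ , ⟨ v₂ , v₅ ⟩ ⟩ ⟩)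
        (π₁ v₁ ∷ π₁ (π₂ v₁) ∷ π₁ (π₂ (π₂ v₁)) ∷ π₂ (π₂ (π₂ v₁)) ∷ v₂ ∷ v₃ ∷ [])
  ∷ [])
  (sub (ifz v₄ ⟨ v₃ , v₂ ⟩
         ⟨ Fᵀ.push (Fᵀ.run v₀) (Fᵀ.push (Fᵀ.muF v₀ v₁ (suc v₂)) v₃) , ⟨ v₁ , suc v₂ ⟩ ⟩)
       (π₁ v₁ ∷ π₁ (π₂ v₁) ∷ π₂ (π₂ v₁) ∷ v₂ ∷ v₃ ∷ []))

stepT : Tm 1
-- A state with empty stack stays fixed; otherwise `predT` undoes the successor of `push`.
stepT = ifz (π₁ v₀) v₀
  (sub (sub frameT (π₁ (π₁ v₀) ∷ π₂ (π₁ v₀) ∷ π₂ v₀ ∷ v₁ ∷ [])) (predT (π₁ v₀) ∷ π₂ v₀ ∷ []))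

next-state : ℕ → ℕ
next-state s = ⟦ stepT ⟧ (s ∷ [])

Halts : ℕ → ℕ → Set
Halts s c = fst (natrec c (λ c _ → next-state c) s) ≡ 0

next-state-frame : ∀ t d S v → next-state (pair° (push (pair° t d) S) v) ≡ ⟦ frameT ⟧ (t ∷ d ∷ S ∷ v ∷ [])
next-state-frame t d S v = begin
  next-state c
    ≡⟨ cong₂ (λ st v → ifzero st c (⟦ inner ⟧ (pred° st ∷ v ∷ []))) (fst-pair° (suc q) v) (snd-pair° (suc q) v) ⟩
  ⟦ frameT ⟧ (fst (fst q) ∷ snd (fst q) ∷ snd q ∷ v ∷ [])
    ≡⟨ cong₂ (λ f S → ⟦ frameT ⟧ (fst f ∷ snd f ∷ S ∷ v ∷ [])) (fst-pair° (pair° t d) S) (snd-pair° (pair° t d) S) ⟩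
  ⟦ frameT ⟧ (fst (pair° t d) ∷ snd (pair° t d) ∷ S ∷ v ∷ [])
    ≡⟨ cong₂ (λ t d → ⟦ frameT ⟧ (t ∷ d ∷ S ∷ v ∷ [])) (fst-pair° t d) (snd-pair° t d) ⟩
  ⟦ frameT ⟧ (t ∷ d ∷ S ∷ v ∷ []) ∎
  where
  open ≡-Reasoning
  q c : ℕ
  q = pair° (pair° t d) S
  c = pair° (suc q) v
  inner : Tm 2
  inner = sub frameT (π₁ (π₁ v₀) ∷ π₂ (π₁ v₀) ∷ π₂ v₀ ∷ v₁ ∷ [])

frame-prc₁ : ∀ g x S v → ⟦ frameT ⟧ (1 ∷ pair° g x ∷ S ∷ v ∷ []) ≡ pair° (push (run g) (push (prc₂ v) S)) x
frame-prc₁ g x S v = cong₂ (λ g x → pair° (push (run g) (push (prc₂ v) S)) x) (fst-pair° g x) (snd-pair° g x)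

frame-rec : ∀ g y i m S v → ⟦ frameT ⟧ (3 ∷ pair° g (pair° y (pair° i m)) ∷ S ∷ v ∷ []) ≡
  ifzero m (pair° S v) (pair° (push (run g) (push (recF g y (suc i) (pred° m)) S)) (pair° y (pair° i v)))
frame-rec g y i m S v = begin
  body (fst d) (fst (snd d)) (fst (snd (snd d))) (snd (snd (snd d)))
    ≡⟨ cong₂ (λ g d → body g (fst d) (fst (snd d)) (snd (snd d))) (fst-pair° g d′) (snd-pair° g d′) ⟩
  body g (fst d′) (fst (snd d′)) (snd (snd d′))
    ≡⟨ cong₂ (λ y d → body g y (fst d) (snd d)) (fst-pair° y (pair° i m)) (snd-pair° y (pair° i m)) ⟩
  body g y (fst (pair° i m)) (snd (pair° i m))
    ≡⟨ cong₂ (body g y) (fst-pair° i m) (snd-pair° i m) ⟩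
  body g y i m ∎
  where
  open ≡-Reasoning
  d d′ : ℕ
  d′ = pair° y (pair° i m)
  d  = pair° g d′
  body : ℕ → ℕ → ℕ → ℕ → ℕ
  body g y i m = ifzero m (pair° S v)
    (pair° (push (run g) (push (recF g y (suc i) (pred° m)) S)) (pair° y (pair° i v)))

frame-mu : ∀ f x n S v → ⟦ frameT ⟧ (4 ∷ pair° f (pair° x n) ∷ S ∷ v ∷ []) ≡
  ifzero v (pair° S n) (pair° (push (run f) (push (muF f x (suc n)) S)) (pair° x (suc n)))
frame-mu f x n S v = begin
  body (fst d) (fst (snd d)) (snd (snd d))
    ≡⟨ cong₂ (λ f d → body f (fst d) (snd d)) (fst-pair° f (pair° x n)) (snd-pair° f (pair° x n)) ⟩
  body f (fst (pair° x n)) (snd (pair° x n))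
    ≡⟨ cong₂ (body f) (fst-pair° x n) (snd-pair° x n) ⟩
  body f x n ∎
  where
  open ≡-Reasoning
  d : ℕ
  d = pair° f (pair° x n)
  body : ℕ → ℕ → ℕ → ℕ
  body f x n = ifzero v (pair° S n) (pair° (push (run f) (push (muF f x (suc n)) S)) (pair° x (suc n)))

natrec-shift : ∀ (f : ℕ → ℕ) c s → natrec c (λ c _ → f c) (suc s) ≡ natrec (f c) (λ c _ → f c) s
natrec-shift f c zero    = refl
natrec-shift f c (suc s) = cong f (natrec-shift f c s)

Halts-push : ∀ {s t d S v c} → ⟦ frameT ⟧ (t ∷ d ∷ S ∷ v ∷ []) ≡ c → Halts s c →
             Halts (suc s) (pair° (push (pair° t d) S) v)
Halts-push {s} {t} {d} {S} {v} {c} refl h =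
  trans (cong fst (trans (natrec-shift next-state (pair° (push (pair° t d) S) v) s)
          (cong (λ c → natrec c (λ c _ → next-state c) s) (next-state-frame t d S v)))) h

Halts-pop : ∀ {s t d S v c} → ⟦ frameT ⟧ (t ∷ d ∷ S ∷ v ∷ []) ≡ c →
            Halts s (pair° (push (pair° t d) S) v) → ∃ λ s′ → s ≡ suc s′ × Halts s′ c
Halts-pop {zero} {t} {d} {S} {v} eq h =
  contradiction (trans (sym (fst-pair° (push (pair° t d) S) v)) h) λ ()
Halts-pop {suc s} {t} {d} {S} {v} refl h = s , refl ,
  trans (cong fst (sym (trans (natrec-shift next-state (pair° (push (pair° t d) S) v) s)
          (cong (λ c → natrec c (λ c _ → next-state c) s) (next-state-frame t d S v))))) h

Halting : ℕ → Set
Halting c = ∃ λ s → Halts s c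

push-Halting : ∀ {t d S v c} → ⟦ frameT ⟧ (t ∷ d ∷ S ∷ v ∷ []) ≡ c → Halting c →
               Halting (pair° (push (pair° t d) S) v)
push-Halting {c = c} eq (s , h) = suc s , Halts-push {s} {c = c} eq h

decode-unpair : ∀ e → decode e ≡ decodeP decode (fst e) (snd e)
decode-unpair e = trans (cong decode (sym (pair°-unpair e))) (decode-pair° (fst e) (snd e))

mutual
  -- Halting is carried backwards from the return of the value to an arbitrary stack `S`; this
  -- continuation form lets the inductive calls compose.
  ⇓⇒Halting : ∀ e {x y} → decode e [ x ]⇓ y → ∀ S → Halting (pair° S y) → Halting (pair° (push (run e) S) x)
  ⇓⇒Halting e p S h = push-Halting refl (run⇒Halting (fst e) (snd e) (decode-unpair e) p S h)

  run⇒Halting : ∀ t a {c x y} → c ≡ decodeP decode t a → c [ x ]⇓ y → ∀ S →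
                Halting (pair° S y) → Halting (⟦ runT ⟧ (t ∷ a ∷ S ∷ x ∷ []))
  run⇒Halting 0 a refl zer  S h = h
  run⇒Halting 1 a refl suc′ S h = h
  run⇒Halting 2 a refl idc  S h = h
  run⇒Halting 3 a refl lft  S h = h
  run⇒Halting 4 a refl rgt  S h = h
  run⇒Halting 5 a {x = x} refl (prc {a = u} {b = w} p q) S h =
    ⇓⇒Halting (fst a) p _
      (push-Halting (frame-prc₁ (snd a) x S u) (⇓⇒Halting (snd a) q _ (push-Halting {v = w} refl h)))
  run⇒Halting 6 a refl (comp p q) S h = ⇓⇒Halting (snd a) p _ (⇓⇒Halting (fst a) q S h)
  run⇒Halting 7 a {x = x} {y} refl (rec p) S h =
    subst (λ m → Halting (pair° (push (run (fst a)) (push (recF (snd a) (fst x) 0 m) S)) (fst x)))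
      (+-identityʳ (snd x))
      (recLoop⇒Halting (fst a) (snd a) p 0 S (push-Halting (frame-rec (snd a) (fst x) (snd x) 0 S y) h))
  run⇒Halting 8 a refl (mu p) S h = muLoop⇒Halting a p S h
  run⇒Halting (suc (suc (suc (suc (suc (suc (suc (suc (suc _))))))))) a refl zer S h = h

  -- The derivation is unwound from its last step: `n` falls and the number `m` of remaining steps
  -- grows, while the machine always starts with `n + m`.
  recLoop⇒Halting : ∀ f g {y n v} → RecLoop (decode f) (decode g) y n v → ∀ m S →
    Halting (pair° (push (recF g y n m) S) v) →
    Halting (pair° (push (run f) (push (recF g y 0 (n + m)) S)) y)
  recLoop⇒Halting f g (base p) m S h = ⇓⇒Halting f p _ h
  recLoop⇒Halting f g {y} (step {n} {v} r p) m S h =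
    subst (λ k → Halting (pair° (push (run f) (push (recF g y 0 k) S)) y)) (+-suc n m)
      (recLoop⇒Halting f g r (suc m) S
        (push-Halting (frame-rec g y n (suc m) S v) (⇓⇒Halting g p _ h)))

  muLoop⇒Halting : ∀ f {x n m} → MuLoop (decode f) x n m → ∀ S → Halting (pair° S m) →
    Halting (pair° (push (run f) (push (muF f x n) S)) (pair° x n))
  muLoop⇒Halting f {x} {n} (stop p)         S h = ⇓⇒Halting f p _ (push-Halting (frame-mu f x n S 0) h)
  muLoop⇒Halting f {x} {n} (next {v = v} p q) S h =
    ⇓⇒Halting f p _ (push-Halting (frame-mu f x n S (suc v)) (muLoop⇒Halting f q S h))

Returns : ℕ → ℕ → (ℕ → Set) → Set
Returns s S P = ∃ λ y → P y × ∃ λ s′ → s′ < s × Halts s′ (pair° S y)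

mutual
  -- Recursion is on a bound `B` for the number of steps: popping a frame costs a step, and the
  -- strict decrease in `Returns` keeps every continuation within the bound.
  Halts⇒⇓ : ∀ B {s} → s < B → ∀ e S x → Halts s (pair° (push (run e) S) x) → Returns s S (decode e [ x ]⇓_)
  Halts⇒⇓ (suc B) {s} (s≤s s≤B) e S x h with Halts-pop {s} refl h
  ... | s₁ , refl , h₁ with run⇒⇓ B (fst e) (snd e) S x s≤B h₁
  ...   | y , p , s′ , s′≤s₁ , h′ = y , subst (_[ x ]⇓ y) (sym (decode-unpair e)) p , s′ , s≤s s′≤s₁ , h′

  run⇒⇓ : ∀ B {s} t a S x → s < B → Halts s (⟦ runT ⟧ (t ∷ a ∷ S ∷ x ∷ [])) →
          ∃ λ y → decodeP decode t a [ x ]⇓ y × ∃ λ s′ → s′ ≤ s × Halts s′ (pair° S y)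
  run⇒⇓ B {s} 0 a S x s<B h = _ , zer , s , ≤-refl , h
  run⇒⇓ B {s} 1 a S x s<B h = _ , suc′ , s , ≤-refl , h
  run⇒⇓ B {s} 2 a S x s<B h = _ , idc , s , ≤-refl , h
  run⇒⇓ B {s} 3 a S x s<B h = _ , lft , s , ≤-refl , h
  run⇒⇓ B {s} 4 a S x s<B h = _ , rgt , s , ≤-refl , h
  run⇒⇓ B {s} 5 a S x s<B h with Halts⇒⇓ B s<B (fst a) _ x h
  ... | u , p , s₁ , s₁<s , h₁ with Halts-pop {s₁} (frame-prc₁ (snd a) x S u) h₁
  ...   | s₂ , refl , h₂ with Halts⇒⇓ B (<-trans (<⇒≤ s₁<s) s<B) (snd a) _ x h₂
  ...     | w , q , s₃ , s₃<s₂ , h₃ with Halts-pop {s₃} {v = w} refl h₃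
  ...       | s₄ , refl , h₄ = _ , prc p q , s₄ ,
    ≤-trans (<⇒≤ (<⇒≤ s₃<s₂)) (<⇒≤ (<⇒≤ s₁<s)) , h₄
  run⇒⇓ B {s} 6 a S x s<B h with Halts⇒⇓ B s<B (snd a) _ x h
  ... | u , p , s₁ , s₁<s , h₁ with Halts⇒⇓ B (<-trans s₁<s s<B) (fst a) S u h₁
  ...   | w , q , s₂ , s₂<s₁ , h₂ = w , comp p q , s₂ , <⇒≤ (<-trans s₂<s₁ s₁<s) , h₂
  run⇒⇓ B {s} 7 a S x s<B h with Halts⇒⇓ B s<B (fst a) _ (fst x) h
  ... | u , p , s₁ , s₁<s , h₁ with recLoop⇒⇓ B (<-trans s₁<s s<B) (fst a) (snd a) (fst x) 0 (snd x) S u (base p) h₁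
  ...   | w , q , s₂ , s₂<s₁ , h₂ = w , rec q , s₂ , <⇒≤ (<-trans s₂<s₁ s₁<s) , h₂
  run⇒⇓ B {s} 8 a S x s<B h with muLoop⇒⇓ B s<B a x 0 S h
  ... | w , q , s₁ , s₁<s , h₁ = w , mu q , s₁ , <⇒≤ s₁<s , h₁
  run⇒⇓ B {s} (suc (suc (suc (suc (suc (suc (suc (suc (suc _))))))))) a S x s<B h = _ , zer , s , ≤-refl , h

  recLoop⇒⇓ : ∀ B {s} → s < B → ∀ f g y i m S v → RecLoop (decode f) (decode g) y i v →
    Halts s (pair° (push (recF g y i m) S) v) → Returns s S (RecLoop (decode f) (decode g) y (i + m))
  recLoop⇒⇓ (suc B) {s} (s≤s s≤B) f g y i zero S v r h with Halts-pop {s} (frame-rec g y i 0 S v) h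
  ... | s₁ , refl , h₁ =
    v , subst (λ n → RecLoop (decode f) (decode g) y n v) (sym (+-identityʳ i)) r , s₁ , ≤-refl , h₁
  recLoop⇒⇓ (suc B) {s} (s≤s s≤B) f g y i (suc m) S v r h with Halts-pop {s} (frame-rec g y i (suc m) S v) h
  ... | s₁ , refl , h₁ with Halts⇒⇓ B s≤B g _ _ h₁
  ...   | u , p , s₂ , s₂<s₁ , h₂ with recLoop⇒⇓ B (<-trans s₂<s₁ s≤B) f g y (suc i) m S u (step r p) h₂
  ...     | w , q , s₃ , s₃<s₂ , h₃ =
    w , subst (λ n → RecLoop (decode f) (decode g) y n w) (sym (+-suc i m)) q ,
    s₃ , <-trans s₃<s₂ (m<n⇒m<1+n s₂<s₁) , h₃

  muLoop⇒⇓ : ∀ B {s} → s < B → ∀ f x n S →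
    Halts s (pair° (push (run f) (push (muF f x n) S)) (pair° x n)) → Returns s S (MuLoop (decode f) x n)
  muLoop⇒⇓ (suc B) {s} (s≤s s≤B) f x n S h with Halts⇒⇓ (suc B) (s≤s s≤B) f _ _ h
  ... | u , p , s₁ , s₁<s , h₁ with Halts-pop {s₁} (frame-mu f x n S u) h₁
  muLoop⇒⇓ (suc B) {s} (s≤s s≤B) f x n S h
      | zero , p , s₁ , s₁<s , h₁ | s₂ , refl , h₂ = n , stop p , s₂ , <⇒≤ s₁<s , h₂
  muLoop⇒⇓ (suc B) {s} (s≤s s≤B) f x n S h
      | suc u , p , s₁ , s₁<s , h₁ | s₂ , refl , h₂ with muLoop⇒⇓ B (<-≤-trans (<⇒≤ s₁<s) s≤B) f x (suc n) S h₂
  ...   | w , q , s₃ , s₃<s₂ , h₃ = w , next p q , s₃ , <-trans s₃<s₂ (<⇒≤ s₁<s) , h₃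

-- Enumeration in stages and agreement of columns

infix 4 _∈W_at_
opaque
  haltT : Tm 3
  haltT = π₁ (nrec ⟨ Fᵀ.push (Fᵀ.run v₁) (lit 0) , v₂ ⟩ (sub stepT (v₀ ∷ [])) v₀)

  _∈W_at_ : ℕ → ℕ → ℕ → Set
  x ∈W e at t = ⟦ haltT ⟧ (t ∷ e ∷ x ∷ []) ≡ 0

  at-≡0 : ∀ {x e t} → ⟦ haltT ⟧ (t ∷ e ∷ x ∷ []) ≡ 0 ⇔ x ∈W e at t
  at-≡0 = mk⇔ id id

  _∈W_at?_ : ∀ x e t → Dec (x ∈W e at t)
  x ∈W e at? t = ⟦ haltT ⟧ (t ∷ e ∷ x ∷ []) ≟ 0

  at-mono-≤ : ∀ {x e t t′} → t ≤ t′ → x ∈W e at t → x ∈W e at t′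
  at-mono-≤ {x} {e} {t} {t′} t≤t′ h =
    subst (λ s → x ∈W e at s) (m∸n+n≡m t≤t′) (iterate (t′ ∸ t))
    where
    halted : ∀ c → fst c ≡ 0 → fst (next-state c) ≡ 0
    halted c eq rewrite eq = eq
    iterate : ∀ d → x ∈W e at (d + t)
    iterate zero    = h
    iterate (suc d) = halted (natrec (pair° (push (run e) 0) x) (λ c _ → next-state c) (d + t)) (iterate d)

  ∈W-at-⇔ : ∀ {x e} → x ∈W e ⇔ (∃ λ t → x ∈W e at t)
  ∈W-at-⇔ {x} {e} = mk⇔
    (λ w → let y , p = to (∈W-⇔ {x} {e}) w in ⇓⇒Halting e p 0 (0 , fst-pair° 0 y))
    (λ (t , h) → let y , p , _ = Halts⇒⇓ (suc t) ≤-refl e 0 x h in from (∈W-⇔ {x} {e}) (y , p))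

col-at-⇔ : ∀ {e n x} → col e n x ⇔ (∃ λ t → pair° x n ∈W e at t)
col-at-⇔ {e} {n} {x} = subst (λ p → p ∈W e ⇔ (∃ λ t → pair° x n ∈W e at t)) (pair°≡pair x n) ∈W-at-⇔

-- By monotonicity the maximum of finitely many witnesses serves for all of them. Here `t` may be a
-- stage, a bound on columns or a level.
collect : ∀ {P : ℕ → ℕ → Set} → (∀ {i t t′} → t ≤ t′ → P i t → P i t′) →
          ∀ n → (∀ i → i < n → ∃ λ t → P i t) → ∃ λ t → ∀ i → i < n → P i t
collect mono zero    f = 0 , λ _ ()
collect {P} mono (suc n) f with collect {P} mono n (λ i i<n → f i (m<n⇒m<1+n i<n)) | f n ≤-refl
... | t , init | t′ , last = t ⊔ t′ , λ i i<1+n →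
  [ (λ i<n → mono (m≤m⊔n t t′) (init i i<n)) , (λ { refl → mono (m≤n⊔m t t′) last }) ]′
  (m<1+n⇒m<n∨m≡n i<1+n)

Halted : Vec ℕ 3 → Set
Halted (t ∷ e ∷ x ∷ []) = x ∈W e at t

haltF : ∀ {n} → Vec (Tm n) 3 → Fm n
haltF = atom Halted haltT λ { (t ∷ e ∷ x ∷ []) → at-≡0 }

-- Variables: k, t, b, e, c, e′, m. What has entered either column by stage k is in the other by stage t, for elements
-- in [b,k): a Π₂ equality ∀k∃t is thus a conjunction over k of increasingly strong Σ₁ conditions.
agreeF : Fm 7
agreeF = all v₀ ((v₀ ≺ v₃) ∨
  ( (haltF (v₁ ∷ v₄ ∷ ⟨ v₀ , v₅ ⟩ ∷ []) ⊃ haltF (v₂ ∷ v₆ ∷ ⟨ v₀ , v₇ ⟩ ∷ []))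
  ∧ (haltF (v₁ ∷ v₆ ∷ ⟨ v₀ , v₇ ⟩ ∷ []) ⊃ haltF (v₂ ∷ v₄ ∷ ⟨ v₀ , v₅ ⟩ ∷ []))))

opaque
  Agree : (k t b e c e′ m : ℕ) → Set
  Agree k t b e c e′ m = ⟦ agreeF ⟧ᶠ (k ∷ t ∷ b ∷ e ∷ c ∷ e′ ∷ m ∷ [])

  -- Lowering `k` shrinks the range and strengthens the premises of the implications; raising `t`
  -- weakens their conclusions.
  Agree-mono : ∀ {k k′ t t′} → k′ ≤ k → t ≤ t′ → ∀ b e c e′ m → Agree k t b e c e′ m → Agree k′ t′ b e c e′ m
  Agree-mono k′≤k t≤t′ b e c e′ m a x x<k′ with a x (<-≤-trans x<k′ k′≤k)
  ... | inj₁ x<b     = inj₁ x<b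
  ... | inj₂ (p , q) = inj₂ ((λ h → at-mono-≤ t≤t′ (p (at-mono-≤ k′≤k h))) ,
                             (λ h → at-mono-≤ t≤t′ (q (at-mono-≤ k′≤k h))))

  Agree-⇔ : ∀ b e c e′ m → (∀ k → ∃ λ t → Agree k t b e c e′ m) ⇔ (∀ x → b ≤ x → col e c x ⇔ col e′ m x)
  Agree-⇔ b e c e′ m = mk⇔ sound complete
    where
    sound : (∀ k → ∃ λ t → Agree k t b e c e′ m) → ∀ x → b ≤ x → col e c x ⇔ col e′ m x
    sound agree x b≤x = mk⇔ (transfer proj₁) (transfer proj₂)
      where
      transfer : ∀ {i j i′ j′} →
        (∀ {k t} → ((pair° x c ∈W e at k → pair° x m ∈W e′ at t) × (pair° x m ∈W e′ at k → pair° x c ∈W e at t)) →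
                   pair° x j ∈W i at k → pair° x j′ ∈W i′ at t) →
        col i j x → col i′ j′ x
      transfer pick w with to col-at-⇔ w
      -- This stage is late enough both to see the enumeration at `s` and to have `x` in range.
      ... | s , h with agree (s ⊔ suc x)
      ...   | t , a with a x (m≤n⊔m s (suc x))
      ...     | inj₁ x<b = contradiction b≤x (<⇒≱ x<b)
      ...     | inj₂ pq  = from col-at-⇔ (t , pick {s ⊔ suc x} {t} pq (at-mono-≤ (m≤m⊔n s (suc x)) h))

    -- Membership by stage `k` is decidable; when it fails, the implication is vacuous and stage 0
    -- will do.
    eventually : ∀ {i j i′ j′ x} k → (col i j x → col i′ j′ x) →
      ∃ λ t → pair° x j ∈W i at k → pair° x j′ ∈W i′ at t
    eventually {i} {j} {i′} {j′} {x} k f with pair° x j ∈W i at? k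
    ... | yes h = let t , h′ = to col-at-⇔ (f (from col-at-⇔ (k , h))) in t , λ _ → h′
    ... | no ¬h = 0 , λ h → contradiction h ¬h

    complete : (∀ x → b ≤ x → col e c x ⇔ col e′ m x) → ∀ k → ∃ λ t → Agree k t b e c e′ m
    complete eqv k = collect (λ {x} → mono x) k λ x _ → stage x
      where
      P : ℕ → ℕ → Set
      P x t = x < b ⊎ ((pair° x c ∈W e at k → pair° x m ∈W e′ at t) × (pair° x m ∈W e′ at k → pair° x c ∈W e at t))
      mono : ∀ x {t t′} → t ≤ t′ → P x t → P x t′
      mono x t≤t′ (inj₁ x<b)     = inj₁ x<b
      mono x t≤t′ (inj₂ (p , q)) = inj₂ ((λ h → at-mono-≤ t≤t′ (p h)) , (λ h → at-mono-≤ t≤t′ (q h)))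
      stage : ∀ x → ∃ (P x)
      stage x with x <? b
      ... | yes x<b = 0 , inj₁ x<b
      ... | no  x≮b =
        let t , p  = eventually k (to (eqv x (≮⇒≥ x≮b)))
            t′ , q = eventually k (from (eqv x (≮⇒≥ x≮b)))
        in t ⊔ t′ , inj₂ ((λ h → at-mono-≤ (m≤m⊔n t t′) (p h)) , (λ h → at-mono-≤ (m≤n⊔m t t′) (q h)))

  agreeT : Tm 7
  agreeT = toTm agreeF

  agreeT-⇔ : ∀ {k t b e c e′ m} → ⟦ agreeT ⟧ (k ∷ t ∷ b ∷ e ∷ c ∷ e′ ∷ m ∷ []) ≡ 0 ⇔ Agree k t b e c e′ m
  agreeT-⇔ {k} {t} {b} {e} {c} {e′} {m} = toTm-correct agreeF (k ∷ t ∷ b ∷ e ∷ c ∷ e′ ∷ m ∷ [])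

callAgree : ∀ {n} → Vec (Tm n) 7 → Fm n
callAgree = atom (λ { (k ∷ t ∷ b ∷ e ∷ c ∷ e′ ∷ m ∷ []) → Agree k t b e c e′ m })
  agreeT λ { (k ∷ t ∷ b ∷ e ∷ c ∷ e′ ∷ m ∷ []) → agreeT-⇔ }

-- The finitary reduction

nthT : Tm 2
nthT = π₁ (predT (nrec v₁ (π₂ (predT v₀)) v₀))

nth : ℕ → ℕ → ℕ
nth i d = ⟦ nthT ⟧ (i ∷ d ∷ [])

nth-codeVec : ∀ {n} (i : Fin n) xs → nth (toℕ i) (codeVec xs) ≡ lookup xs i
nth-codeVec zero    (x ∷ xs) = fst-pair x (codeVec xs)
nth-codeVec (suc i) (x ∷ xs) = begin
  nth (suc (toℕ i)) (codeVec (x ∷ xs))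
    ≡⟨ cong (λ d → fst (pred° d)) (natrec-shift (λ d → snd (pred° d)) (codeVec (x ∷ xs)) (toℕ i)) ⟩
  nth (toℕ i) (snd (pair x (codeVec xs))) ≡⟨ cong (nth (toℕ i)) (snd-pair x (codeVec xs)) ⟩
  nth (toℕ i) (codeVec xs)                ≡⟨ nth-codeVec i xs ⟩
  lookup xs i                             ∎
  where open ≡-Reasoning

-- This provides the code of a guess with prescribed membership values below `n`.
nth-tabulate : ∀ (f : ℕ → ℕ) {n a} → a < n → nth a (codeVec (tabulate {n = n} (f ∘ toℕ))) ≡ f a
nth-tabulate f {n} {a} a<n = begin
  nth a d                         ≡⟨ cong (λ a → nth a d) (toℕ-fromℕ< a<n) ⟨
  nth (toℕ i) d                   ≡⟨ nth-codeVec i (tabulate (f ∘ toℕ)) ⟩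
  lookup (tabulate (f ∘ toℕ)) i   ≡⟨ lookup∘tabulate (f ∘ toℕ) i ⟩
  f (toℕ i)                       ≡⟨ cong f (toℕ-fromℕ< a<n) ⟩
  f a                             ∎
  where
  open ≡-Reasoning
  i = fromℕ< a<n
  d = codeVec (tabulate {n = n} (f ∘ toℕ))

-- Variables: a, b, h, k, t, c, xs.
inclF : Fm 7
inclF = all (suc v₅) (any v₃ (callAgree
  (v₅ ∷ v₆ ∷ lit 0 ∷ sub nthT (v₂ ∷ v₈ ∷ []) ∷ v₁ ∷ sub nthT (v₃ ∷ v₈ ∷ []) ∷ v₀ ∷ [])))

-- Variables: k, t, r, c, n, xs. Up to stage k, some h < r witnesses an inclusion of a in b that contradicts the guess
-- coded by fst r, where a is in and b is out.
firesF : Fm 6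
firesF = any v₄ (any v₅ (any v₄
  ((sub nthT (v₂ ∷ π₁ v₅ ∷ []) ≐0) ∧ (((sub nthT (v₁ ∷ π₁ v₅ ∷ []) ≐0) ⊃ (lit 1 ≐0)) ∧
   call inclF (v₂ ∷ v₁ ∷ v₀ ∷ v₃ ∷ v₄ ∷ v₆ ∷ v₈ ∷ [])))))

-- Variables: t, x, c, i, n, xs. Here x = ⟨r,k⟩ with r = ⟨d,s⟩ codes the k-th element of cell r, and d codes a guess at
-- an upward closed subset of {0,…,n−1}. If the witnesses below r against d fire exactly up to some stage, a single
-- element of the cell keeps the pattern d, the earlier ones being in every set and the later ones in none.
memberF : Fm 6
memberF =
  ((sub nthT (v₃ ∷ π₁ (π₁ v₁) ∷ []) ≐0) ∧ ((π₂ v₁ ≐0) ∨ fires (predT (π₂ v₁)))) ∨ fires (π₂ v₁)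
  where
  fires : Tm 6 → Fm 6
  fires k = call firesF (k ∷ v₀ ∷ π₁ v₁ ∷ v₂ ∷ v₄ ∷ v₅ ∷ [])

reduct : (n : ℕ) → ℕ → ℕ → ℕ
reduct n i xs = smn (indexOf memberF) (enc (i ∷ n ∷ xs ∷ []))

Incl : ℕ → ℕ → Set
Incl i j = ∀ n → ∃ λ m → SameSet (col i n) (col j m)

SameSet-sym : ∀ {A B} → SameSet A B → SameSet B A
SameSet-sym s x = mk⇔ (from (s x)) (to (s x))

SameSet-trans : ∀ {A B C} → SameSet A B → SameSet B C → SameSet A C
SameSet-trans s r x = mk⇔ (to (r x) ∘ to (s x)) (from (s x) ∘ from (r x))

Eset⇔Incl : ∀ {i j} → Eset i j ⇔ (Incl i j × Incl j i)
Eset⇔Incl = mk⇔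
  (λ (p , q) → p , λ n → let m , s = q n in m , SameSet-sym s)
  (λ (p , q) → p , λ n → let m , s = q n in m , SameSet-sym s)

Incl-trans : ∀ {i j k} → Incl i j → Incl j k → Incl i k
Incl-trans p q n = let m , s = p n ; l , r = q m in l , SameSet-trans s r

_⊆*_ : (ℕ → Set) → (ℕ → Set) → Set
A ⊆* B = ∃ λ b → ∀ x → b ≤ x → A x → B x

E3⇔⊆* : ∀ {i j} → E3 i j ⇔ ((∀ c → col i c ⊆* col j c) × (∀ c → col j c ⊆* col i c))
E3⇔⊆* {i} {j} = mk⇔ split unite
  where
  split : E3 i j → (∀ c → col i c ⊆* col j c) × (∀ c → col j c ⊆* col i c)
  split e = (λ c → proj₁ (e c) , λ x b≤x → to (proj₂ (e c) x b≤x)) ,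
            (λ c → proj₁ (e c) , λ x b≤x → from (proj₂ (e c) x b≤x))
  unite : (∀ c → col i c ⊆* col j c) × (∀ c → col j c ⊆* col i c) → E3 i j
  unite (p , q) c with p c | q c
  ... | b , f | b′ , g = b ⊔ b′ , λ x le →
    mk⇔ (f x (≤-trans (m≤m⊔n b b′) le)) (g x (≤-trans (m≤n⊔m b b′) le))

-- The diagonal argument

Lists : {I : Set} → ℕ → (I → ℕ → Set) → Set
Lists e F = (∀ n → ∃ λ i → SameSet (col e n) (F i)) × (∀ i → ∃ λ n → SameSet (col e n) (F i))

Lists⇒Eset : ∀ {I} {F : I → ℕ → Set} {e e′} → Lists e F → Lists e′ F → Eset e e′
Lists⇒Eset (f , f′) (g , g′) =
  (λ n → let i , s = f n ; m , r = g′ i in m , SameSet-trans s (SameSet-sym r)) ,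
  (λ m → let i , r = g m ; n , s = f′ i in n , SameSet-trans s (SameSet-sym r))

Segment : ℕ → ℕ → Set
Segment b x = x < b

Segment∞ : Maybe ℕ → ℕ → Set
Segment∞ nothing  x = ⊤
Segment∞ (just b) x = x < b

-- fst j ≡ 0 → 1 ≡ 0 is how the formula language negates fst j ≡ 0.
Tagged : ℕ → (ℕ → ℕ → Set) → Set
Tagged e Q = ∀ j x → col e j x ⇔ ((fst j ≡ 0 × x < snd j) ⊎ ((fst j ≡ 0 → 1 ≡ 0) × Q (snd j) x))

-- Variables: t, x, j, and the parameters of φ.
taggedF : ∀ {n} → Fm (3 + n) → Fm (3 + n)
taggedF φ = ((π₁ v₂ ≐0) ∧ (v₁ ≺ π₂ v₂)) ∨ (((π₁ v₂ ≐0) ⊃ (lit 1 ≐0)) ∧ φ)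

taggedIndex : ∀ {n} → Fm (3 + n) → Vec ℕ n → ℕ
taggedIndex φ v = smn (indexOf (taggedF φ)) (enc v)

taggedIndex-Tagged : ∀ {n} (φ : Fm (3 + n)) v {Q} →
  (∀ j x → (∃ λ t → ⟦ φ ⟧ᶠ (t ∷ x ∷ j ∷ v)) ⇔ Q (snd j) x) → Tagged (taggedIndex φ v) Q
taggedIndex-Tagged φ v {Q} spec j x = mk⇔ (split ∘ to C) (from C ∘ unite)
  where
  C = col-smn (taggedF φ) v j x
  Column : Set
  Column = (fst j ≡ 0 × x < snd j) ⊎ ((fst j ≡ 0 → 1 ≡ 0) × Q (snd j) x)
  split : (∃ λ t → ⟦ taggedF φ ⟧ᶠ (t ∷ x ∷ j ∷ v)) → Column
  split (t , inj₁ p)       = inj₁ p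
  split (t , inj₂ (p , q)) = inj₂ (p , to (spec j x) (t , q))
  unite : Column → ∃ λ t → ⟦ taggedF φ ⟧ᶠ (t ∷ x ∷ j ∷ v)
  unite (inj₁ p)       = 0 , inj₁ p
  unite (inj₂ (p , q)) = let t , q′ = from (spec j x) q in t , inj₂ (p , q′)

-- The false formula leaves the columns with nonzero tag empty, which is again a segment; the true
-- one makes them all of ω.
segments segments∞ : ℕ
segments  = taggedIndex {0} (lit 1 ≐0) []
segments∞ = taggedIndex {0} (lit 0 ≐0) []

FiniteDiff-sym : ∀ {A B} → FiniteDiff A B → FiniteDiff B A
FiniteDiff-sym (b , f) = b , λ x b≤x → mk⇔ (from (f x b≤x)) (to (f x b≤x))

FiniteDiff-trans : ∀ {A B C} → FiniteDiff A B → FiniteDiff B C → FiniteDiff A C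
FiniteDiff-trans (b , f) (b′ , g) = b ⊔ b′ , λ x le →
  let f′ = f x (≤-trans (m≤m⊔n b b′) le) ; g′ = g x (≤-trans (m≤n⊔m b b′) le) in
  mk⇔ (to g′ ∘ to f′) (from f′ ∘ from g′)

-- Variables: t, x, j, k, u. With u the index of the program itself, smn u ⟨k,u⟩ is the set being enumerated, so the
-- program can consult g at its own index.
module Self (g : ℕ → ℕ) (g-computable : Computable g) where

  selfF : Fm 5
  -- The stage is `x` and the offset `b` is `snd j`. A column with nonzero tag is therefore ω if the
  -- two `k`-th columns agree from `b` on, and otherwise a finite initial segment.
  selfF = callAgree (v₁ ∷ v₀ ∷ π₂ v₂ ∷ g[self] ∷ v₃ ∷ lit (g segments) ∷ v₃ ∷ [])
    where
    g[self] : Tm 5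
    g[self] = app (decode (proj₁ g-computable)) g
      (λ x → let k , eq = proj₂ g-computable x in eval-sound k (decode (proj₁ g-computable)) eq)
      (sub smnT (v₄ ∷ ⟨ ⟨ lit 0 , v₄ ⟩ , v₃ ⟩ ∷ []))

  self : ℕ → ℕ
  self k = taggedIndex selfF (k ∷ indexOf (taggedF selfF) ∷ [])

  Agrees : (k b x : ℕ) → Set
  Agrees k b x = ∃ λ t → Agree x t b (g (self k)) k (g segments) k

  -- The fixed point equation is definitional: `g[self]` evaluates to `g (self k)` in the
  -- environment chosen for `self`.
  self-Tagged : ∀ k → Tagged (self k) (Agrees k)
  self-Tagged k = taggedIndex-Tagged selfF (k ∷ indexOf (taggedF selfF) ∷ []) {Agrees k} λ j x → mk⇔ id id

-- Classical principles

module Classical (em : ExcludedMiddle 0ℓ) where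

  dne : {P : Set} → ¬ ¬ P → P
  dne {P} ¬¬p with em {P}
  ... | yes p = p
  ... | no ¬p = contradiction ¬p ¬¬p

  ¬∀⇒∃¬ : {P : ℕ → Set} → ¬ (∀ n → P n) → ∃ λ n → ¬ P n
  ¬∀⇒∃¬ {P} ¬∀ = dne λ ¬∃ → ¬∀ λ n → dne λ ¬p → ¬∃ (n , ¬p)

  -- Descending from a failure stops at 0 or just above a success; for decreasing `P` this is the
  -- least failure. The disjunction has the form tested by `memberF`.
  least-failure : {P : ℕ → Set} → ¬ (∀ n → P n) → ∃ λ k → ¬ P k × (k ≡ 0 ⊎ P (pred° k))
  least-failure {P} ¬∀ = let n , ¬p = ¬∀⇒∃¬ ¬∀ in go n ¬p
    where
    go : ∀ n → ¬ P n → ∃ λ k → ¬ P k × (k ≡ 0 ⊎ P (pred° k))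
    go zero    ¬p = 0 , ¬p , inj₁ refl
    go (suc n) ¬p with em {P n}
    ... | yes p  = suc n , ¬p , inj₂ p
    ... | no ¬p′ = go n ¬p′

  -- Correctness of the finitary reduction

  module Reduction (n xs : ℕ) where

    X : ℕ → ℕ
    X a = nth a xs

    In : ℕ → ℕ → Set
    In d a = nth a d ≡ 0

    Looks : (a b h k t c : ℕ) → Set
    Looks a b h k t c = ∀ i → i < suc c → ∃ λ m → m < h × Agree k t 0 (X a) i (X b) m

    Fires : (r c k : ℕ) → Set
    Fires r c k = ∃ λ t → ⟦ firesF ⟧ᶠ (k ∷ t ∷ r ∷ c ∷ n ∷ xs ∷ [])

    Fires-mono : ∀ {r c k k′} → k′ ≤ k → Fires r c k → Fires r c k′
    Fires-mono k′≤k (t , a , a<n , b , b<n , h , h<r , a∈ , b∉ , look) =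
      t , a , a<n , b , b<n , h , h<r , a∈ , b∉ , λ i i≤c →
        let m , m<h , g = look i i≤c in m , m<h , Agree-mono k′≤k ≤-refl 0 (X a) i (X b) m g

    MemberAt : (i c r k : ℕ) → Set
    MemberAt i c r k = (In (fst r) i × (k ≡ 0 ⊎ Fires r c (pred° k))) ⊎ Fires r c k

    Member : ℕ → ℕ → ℕ → Set
    Member i c x = MemberAt i c (fst x) (snd x)

    col-reduct : ∀ {i c x} → col (reduct n i xs) c x ⇔ Member i c x
    col-reduct {i} {c} {x} = mk⇔ (split ∘ to C) (from C ∘ unite)
      where
      C = col-smn memberF (i ∷ n ∷ xs ∷ []) c x
      split : (∃ λ t → ⟦ memberF ⟧ᶠ (t ∷ x ∷ c ∷ i ∷ n ∷ xs ∷ [])) → Member i c x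
      split (t , inj₁ (i∈ , inj₁ z)) = inj₁ (i∈ , inj₁ z)
      split (t , inj₁ (i∈ , inj₂ f)) = inj₁ (i∈ , inj₂ (t , f))
      split (t , inj₂ f)             = inj₂ (t , f)
      unite : Member i c x → ∃ λ t → ⟦ memberF ⟧ᶠ (t ∷ x ∷ c ∷ i ∷ n ∷ xs ∷ [])
      unite (inj₁ (i∈ , inj₁ z))       = 0 , inj₁ (i∈ , inj₁ z)
      unite (inj₁ (i∈ , inj₂ (t , f))) = t , inj₁ (i∈ , inj₂ f)
      unite (inj₂ (t , f))             = t , inj₂ f

    -- Only the columns 0,...,c matter, so one `h` bounds their matching columns. Every cell above
    -- `h` may use it as a witness, and for each `k` the finitely many agreements share a stage.
    Fires-always : ∀ {a b} → a < n → b < n → Incl (X a) (X b) → ∀ c → ∃ λ h → ∀ r → h < r →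
                   In (fst r) a → ¬ In (fst r) b → ∀ k → Fires r c k
    Fires-always {a} {b} a<n b<n incl c = h , λ r h<r a∈ b∉ k →
      let t , look = collect {λ i t → ∃ λ m → m < h × Agree k t 0 (X a) i (X b) m}
            (λ { t≤t′ (m , m<h , g) → m , m<h , Agree-mono ≤-refl t≤t′ 0 (X a) _ (X b) m g })
            (suc c)
            (λ i i≤c → let m , m<h , s = witness i i≤c
                           t , g = from (Agree-⇔ 0 (X a) i (X b) m) (λ x _ → s x) k
                       in t , m , m<h , g)
      in t , a , a<n , b , b<n , h , h<r , a∈ , (λ b∈ → contradiction b∈ b∉) , look
      where
      collected = collect {λ i h → ∃ λ m → m < h × SameSet (col (X a) i) (col (X b) m)}
        (λ { h≤h′ (m , m<h , s) → m , <-≤-trans m<h h≤h′ , s }) (suc c)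
        -- The successor appears because the matching column must lie strictly below the bound.
        (λ i _ → let m , s = incl i in suc m , m , ≤-refl , s)
      h       = proj₁ collected
      witness = proj₂ collected

    -- In a cell above `h` the guess either contains `b` along with `a`, or separates them and then
    -- fires forever. Each of the finitely many other cells is harmless from some position on.
    Incl⇒⊆* : ∀ {a b} → a < n → b < n → Incl (X a) (X b) → ∀ c →
              col (reduct n a xs) c ⊆* col (reduct n b xs) c
    -- By monotonicity of pairing, a larger element has cell above `h` or position at least `K`.
    Incl⇒⊆* {a} {b} a<n b<n incl c = suc (pair h K) , λ x x> w →
      from (col-reduct {b} {c} {x}) (include x x> (to (col-reduct {a} {c} {x}) w))
      where
      always = Fires-always a<n b<n incl c
      h = proj₁ always
      cell : ∀ r → r < suc h → ∃ λ K → ∀ k → K ≤ k →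
             MemberAt a c r k → Fires r c k
      cell r _ with em {∀ k → Fires r c k}
      ... | yes f = 0 , λ k _ _ → f k
      -- The successor excludes position 0 and places the predecessor at or beyond the failure, so
      -- only the firing clause can hold.
      ... | no ¬f = let k₀ , ¬fk₀ = ¬∀⇒∃¬ {Fires r c} ¬f in suc k₀ , λ where
        (suc k) (s≤s k₀≤k) (inj₁ (_ , inj₂ f)) → contradiction (Fires-mono k₀≤k f) ¬fk₀
        k       _          (inj₂ f)            → f
      cells = collect {λ r K → ∀ k → K ≤ k → MemberAt a c r k → Fires r c k}
        (λ K≤K′ f k K′≤k → f k (≤-trans K≤K′ K′≤k)) (suc h) cell
      K = proj₁ cells
      include : ∀ x → suc (pair h K) ≤ x → Member a c x → Member b c x
      include x x> w with suc h ≤? fst x | K ≤? snd x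
      ... | no h≮r  | no K≰k  = contradiction (subst (_≤ pair h K) (pair-unpair x)
                                  (pair-mono-≤ (≮⇒≥ h≮r) (<⇒≤ (≰⇒> K≰k)))) (<⇒≱ x>)
      ... | no h≮r  | yes K≤k = inj₂ (proj₂ cells (fst x) (s≤s (≮⇒≥ h≮r)) (snd x) K≤k w)
      ... | yes h<r | _ with w
      ...   | inj₂ f        = inj₂ f
      ...   | inj₁ (a∈ , f) with nth b (fst (fst x)) ≟ 0
      ...     | yes b∈ = inj₁ (b∈ , f)
      ...     | no  b∉ = inj₂ (proj₂ always (fst x) h<r a∈ b∉ (snd x))

    -- Since there are only finitely many pairs below n, a single c refutes all failing inclusions.
    Incl-level : ∃ λ c → ∀ a → a < n → ∀ b → b < n →
                 (∀ i → i < suc c → ∃ λ m → SameSet (col (X a) i) (col (X b) m)) → Incl (X a) (X b)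
    Incl-level = collect {λ a c → ∀ b → b < n → Good c a b} (λ {a} c≤c′ g b b<n → mono a b c≤c′ (g b b<n)) n
      λ a _ → collect {λ b c → Good c a b} (λ {b} → mono a b) n λ b _ → level a b
      where
      Good : ℕ → ℕ → ℕ → Set
      Good c a b = (∀ i → i < suc c → ∃ λ m → SameSet (col (X a) i) (col (X b) m)) → Incl (X a) (X b)
      mono : ∀ a b {c c′} → c ≤ c′ → Good c a b → Good c′ a b
      mono a b c≤c′ g f = g λ i i<c → f i (<-≤-trans i<c (s≤s c≤c′))
      level : ∀ a b → ∃ λ c → Good c a b
      level a b with em {Incl (X a) (X b)}
      ... | yes p = 0 , λ _ → p
      ... | no ¬p = let c , ¬c = ¬∀⇒∃¬ ¬p in c , λ f → contradiction (f c ≤-refl) ¬c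

    -- This need not be computable: only its table below `n` is used, as a guess that some cell
    -- carries. The value 0 means membership, as in `In`.
    above : ℕ → ℕ → ℕ
    above a b with em {Incl (X a) (X b)}
    ... | yes _ = 0
    ... | no  _ = 1

    above-⇔ : ∀ {a b} → above a b ≡ 0 ⇔ Incl (X a) (X b)
    above-⇔ {a} {b} with em {Incl (X a) (X b)}
    ... | yes p = mk⇔ (λ _ → p) (λ _ → refl)
    ... | no ¬p = mk⇔ (λ ()) (λ p → contradiction p ¬p)

    module Separate {a b : ℕ} (a<n : a < n) (b<n : b < n)
      (c : ℕ) (level : ∀ a → a < n → ∀ b → b < n →
        (∀ i → i < suc c → ∃ λ m → SameSet (col (X a) i) (col (X b) m)) → Incl (X a) (X b))
      (d : ℕ) (d-spec : ∀ {b} → b < n → In d b ⇔ Incl (X a) (X b))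
      (B : ℕ) (incl* : ∀ x → B ≤ x → col (reduct n a xs) c x → col (reduct n b xs) c x) where

      r : ℕ
      -- The second component is padding: it makes every element of the cell at least `B`.
      r = pair° d B

      d-⇔ : ∀ {b} → b < n → In (fst r) b ⇔ Incl (X a) (X b)
      d-⇔ {b} b<n = subst (λ d → In d b ⇔ Incl (X a) (X b)) (sym (fst-pair° d B)) (d-spec b<n)

      Witness : (k a b h : ℕ) → Set
      Witness k a b h = ∃ λ t → In (fst r) a × (In (fst r) b → 1 ≡ 0) × Looks a b h k t c

      Witness-mono : ∀ a b h {k k′} → k ≤ k′ → ¬ Witness k a b h → ¬ Witness k′ a b h
      Witness-mono a b h k≤k′ ¬w (t , a∈ , b∉ , look) = ¬w (t , a∈ , b∉ , λ i i≤c →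
        let m , m<h , g = look i i≤c in m , m<h , Agree-mono k≤k′ ≤-refl 0 (X a) i (X b) m g)

      -- If a′ is in the guess and b′ is not, transitivity forbids an inclusion of a′ in b′, so by
      -- `level` some column `i` up to `c` has no match. It disagrees with each of the columns below
      -- `h` at some stage; take a common one.
      refute : ∀ a′ → a′ < n → ∀ b′ → b′ < n → ∀ h → ∃ λ k → ¬ Witness k a′ b′ h
      refute a′ a′<n b′ b′<n h with em {In (fst r) a′} | em {In (fst r) b′}
      ... | no a∉  | _      = 0 , λ (_ , a∈ , _) → a∉ a∈
      ... | yes _  | yes b∈ = 0 , λ (_ , _ , b∉ , _) → contradiction (b∉ b∈) λ ()
      ... | yes a∈ | no b∉  =
        let k , ¬agree = collect {λ m k → ¬ ∃ λ t → Agree k t 0 (X a′) i (X b′) m}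
              (λ {m} k≤k′ ¬g (t , g) → ¬g (t , Agree-mono k≤k′ ≤-refl 0 (X a′) i (X b′) m g)) h
              λ m _ → ¬∀⇒∃¬ {λ k → ∃ λ t → Agree k t 0 (X a′) i (X b′) m} λ g → ¬same (i≤c , m , λ x → to (Agree-⇔ 0 (X a′) i (X b′) m) g x z≤n)
        in k , λ (t , _ , _ , look) → let m , m<h , g = look i i≤c in ¬agree m m<h (t , g)
        where
        Same : ℕ → Set
        Same i = i < suc c → ∃ λ m → SameSet (col (X a′) i) (col (X b′) m)
        unmatched : ∃ λ i → ¬ Same i
        unmatched = ¬∀⇒∃¬ {Same} λ same → b∉ (from (d-⇔ b′<n)
          (Incl-trans (to (d-⇔ a′<n) a∈) (level a′ a′<n b′ b′<n same)))
        i = proj₁ unmatched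
        i≤c : i < suc c
        i≤c = dne λ i≰c → proj₂ unmatched λ i≤c → contradiction i≤c i≰c
        ¬same : ¬ (i < suc c × ∃ λ m → SameSet (col (X a′) i) (col (X b′) m))
        ¬same (_ , same) = proj₂ unmatched λ _ → same

      -- There are finitely many candidate triples (a, b, h), so one stage refutes them all.
      rarely : ¬ (∀ k → Fires r c k)
      rarely fires =
        let K , ¬w = collect {λ a k → ∀ b → b < n → ∀ h → h < r → ¬ Witness k a b h}
              (λ {a} k≤k′ ¬w b b<n h h<r → Witness-mono a b h k≤k′ (¬w b b<n h h<r)) n λ a a<n →
              collect {λ b k → ∀ h → h < r → ¬ Witness k a b h}
                (λ {b} k≤k′ ¬w h h<r → Witness-mono a b h k≤k′ (¬w h h<r)) n λ b b<n →
                collect {λ h k → ¬ Witness k a b h} (λ {h} → Witness-mono a b h) r λ h _ → refute a a<n b b<n h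
            t , a , a<n , b , b<n , h , h<r , a∈ , b∉ , look = fires K
        in ¬w a a<n b b<n h h<r (t , a∈ , b∉ , look)

      transfer : ∀ k → MemberAt a c r k → MemberAt b c r k
      transfer k w = subst₂ (MemberAt b c) (fst-pair° r k) (snd-pair° r k)
        (to (col-reduct {b} {c} {pair° r k}) (incl* (pair° r k) (≤-trans (n≤pair° d B) (m≤pair° r k))
          (from (col-reduct {a} {c} {pair° r k})
            (subst₂ (MemberAt a c) (sym (fst-pair° r k)) (sym (snd-pair° r k)) w))))

      -- At the first position without firing, the element belongs to the set of `a`, as `a` lies in
      -- its own guess. It transfers to the set of `b`, where only membership of `b` in the guess
      -- can explain it.
      absurd : ¬ ¬ Incl (X a) (X b)
      absurd ¬incl = separate (least-failure {Fires r c} rarely)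
        where
        separate : ¬ ∃ λ k → ¬ Fires r c k × (k ≡ 0 ⊎ Fires r c (pred° k))
        separate (k , ¬f , k≡0⊎f) =
          [ (λ (b∈ , _) → ¬incl (to (d-⇔ b<n) b∈)) , ¬f ]′
          (transfer k (inj₁ (from (d-⇔ a<n) (λ n → n , λ x → mk⇔ id id) , k≡0⊎f)))

    ⊆*⇒Incl : ∀ {a b} → a < n → b < n → (∀ c → col (reduct n a xs) c ⊆* col (reduct n b xs) c) →
              Incl (X a) (X b)
    ⊆*⇒Incl {a} {b} a<n b<n sub* with Incl-level
    ... | c , level with sub* c
    ...   | B , incl* = dne (Separate.absurd a<n b<n c level (codeVec (tabulate {n = n} (above a ∘ toℕ)))
      (λ {b} b<n → subst (λ v → v ≡ 0 ⇔ Incl (X a) (X b)) (sym (nth-tabulate (above a) b<n)) above-⇔)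
      B incl*)

    Eset⇔E3 : ∀ {a b} → a < n → b < n → Eset (X a) (X b) ⇔ E3 (reduct n a xs) (reduct n b xs)
    Eset⇔E3 a<n b<n = mk⇔
      (λ e → let p , q = to Eset⇔Incl e in from E3⇔⊆* (Incl⇒⊆* a<n b<n p , Incl⇒⊆* b<n a<n q))
      (λ e → let p , q = to E3⇔⊆* e in from Eset⇔Incl (⊆*⇒Incl a<n b<n p , ⊆*⇒Incl b<n a<n q))

  finitary : FinitaryReducible Eset E3
  finitary = (λ n i xs → reduct n i (codeVec xs)) , (proj₁ code , correct-code) , correct
    where
    reductT : Tm 1
    -- The input ⟨n,⟨i,c⟩⟩ is rearranged into `enc (i ∷ n ∷ c ∷ [])`.
    reductT = sub smnT (lit (indexOf memberF) ∷
      ⟨ ⟨ ⟨ lit 0 , π₂ (π₂ v₀) ⟩ , π₁ v₀ ⟩ , π₁ (π₂ v₀) ⟩ ∷ [])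
    code = computable reductT
    args : ℕ → ℕ → ℕ → ℕ
    args n i c = pair° (pair° (pair° 0 c) n) i
    correct-code : ∀ n i (xs : Vec ℕ n) →
      proj₁ code · pair n (pair i (codeVec xs)) ↓= reduct n i (codeVec xs)
    correct-code n i xs = subst (proj₁ code · pair n q ↓=_) (cong (smn (indexOf memberF)) eq) (proj₂ code (pair n q))
      where
      q = pair i (codeVec xs)
      eq : args (fst (pair n q)) (fst (snd (pair n q))) (snd (snd (pair n q))) ≡ args n i (codeVec xs)
      eq = trans (cong₂ (λ n q → args n (fst q) (snd q)) (fst-pair n q) (snd-pair n q))
                 (cong₂ (args n) (fst-pair i (codeVec xs)) (snd-pair i (codeVec xs)))
    correct : ∀ n (xs : Vec ℕ n) (i j : Fin n) → toℕ i < toℕ j →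
      Eset (lookup xs i) (lookup xs j) ⇔ E3 (reduct n (toℕ i) (codeVec xs)) (reduct n (toℕ j) (codeVec xs))
    correct n xs i j _ =
      subst₂ (λ x y → Eset x y ⇔ E3 (reduct n (toℕ i) (codeVec xs)) (reduct n (toℕ j) (codeVec xs)))
        (nth-codeVec i xs) (nth-codeVec j xs)
        (Reduction.Eset⇔E3 n (codeVec xs) (toℕ<n i) (toℕ<n j))

  -- Irreducibility

  threshold : {P : ℕ → Set} → (∀ {x y} → x ≤ y → P y → P x) → ¬ (∀ x → P x) → ∃ λ K → SameSet P (_< K)
  threshold {P} decreasing ¬∀ = finish (least-failure {P} ¬∀)
    where
    finish : (∃ λ k → ¬ P k × (k ≡ 0 ⊎ P (pred° k))) → ∃ λ K → SameSet P (_< K)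
    -- As `P` is decreasing, the failure found is the least one, hence the length of the segment.
    finish (K , ¬p , q) = K , λ x → mk⇔ (λ p → ≰⇒> λ K≤x → ¬p (decreasing K≤x p)) (below K q)
      where
      below : ∀ K {x} → K ≡ 0 ⊎ P (pred° K) → x < K → P x
      below (suc K) (inj₂ p) (s≤s x≤K) = decreasing x≤K p

  module _ {e : ℕ} {Q : ℕ → ℕ → Set} (tagged : Tagged e Q)
           (decreasing : ∀ b {x y} → x ≤ y → Q b y → Q b x) where

    column-zero : ∀ {j} → fst j ≡ 0 → SameSet (col e j) (Segment (snd j))
    column-zero {j} z x = mk⇔
      (λ w → [ proj₂ , (λ (p , _) → contradiction (p z) λ ()) ]′ (to (tagged j x) w))
      (λ x<b → from (tagged j x) (inj₁ (z , x<b)))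

    column-nonzero : ∀ {j} → ¬ fst j ≡ 0 → SameSet (col e j) (Q (snd j))
    column-nonzero {j} nz x = mk⇔
      (λ w → [ (λ (z , _) → contradiction z nz) , proj₂ ]′ (to (tagged j x) w))
      (λ q → from (tagged j x) (inj₂ ((λ z → contradiction z nz) , q)))

    segment-column : ∀ b → SameSet (col e (pair 0 b)) (Segment b)
    segment-column b = subst (λ b′ → SameSet (col e (pair 0 b)) (Segment b′)) (snd-pair 0 b)
      (column-zero (fst-pair 0 b))

    -- A column with nonzero tag is downward closed and proper, so it is a segment; tag 0 already
    -- supplies all segments.
    Lists-Segment : (∀ b → ¬ ∀ x → Q b x) → Lists e Segment
    Lists-Segment ¬all = column , λ b → pair 0 b , segment-column b
      where
      column : ∀ j → ∃ λ b → SameSet (col e j) (Segment b)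
      column j with fst j ≟ 0
      ... | yes z = snd j , column-zero z
      ... | no nz = let K , s = threshold (decreasing (snd j)) (¬all (snd j)) in
        K , SameSet-trans (column-nonzero nz) s

    -- Downward closed columns are segments or ω, and column ⟨1,b⟩ realises ω.
    Lists-Segment∞ : ∀ b → (∀ x → Q b x) → Lists e Segment∞
    Lists-Segment∞ b all-b = column , row
      where
      full : ∀ {P : ℕ → Set} → (∀ x → P x) → SameSet P (Segment∞ nothing)
      full p x = mk⇔ (λ _ → tt) (λ _ → p x)
      column : ∀ j → ∃ λ i → SameSet (col e j) (Segment∞ i)
      column j with fst j ≟ 0
      ... | yes z = just (snd j) , column-zero z
      ... | no nz with em {∀ x → Q (snd j) x}
      ...   | yes f = nothing , SameSet-trans (column-nonzero nz) (full f)
      ...   | no ¬f = let K , s = threshold (decreasing (snd j)) ¬f in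
        just K , SameSet-trans (column-nonzero nz) s
      row : ∀ i → ∃ λ n → SameSet (col e n) (Segment∞ i)
      row (just b′) = pair 0 b′ , segment-column b′
      row nothing   = pair 1 b , SameSet-trans
        (column-nonzero (λ z → contradiction (trans (sym (fst-pair 1 b)) z) λ ()))
        (subst (λ b → SameSet (Q b) (λ _ → ⊤)) (sym (snd-pair 1 b)) (full all-b))

  segments-Lists : Lists segments Segment
  segments-Lists = Lists-Segment
    (taggedIndex-Tagged {0} (lit 1 ≐0) [] {λ _ _ → ⊥} λ j x → mk⇔ (λ ()) (λ ()))
    (λ _ _ ()) (λ b f → f 0)

  segments∞-Lists : Lists segments∞ Segment∞
  segments∞-Lists = Lists-Segment∞
    (taggedIndex-Tagged {0} (lit 0 ≐0) [] {λ _ _ → ⊤} λ j x → mk⇔ (λ _ → tt) (λ _ → 0 , refl))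
    (λ _ _ _ → tt) 0 (λ _ → tt)

  segments≁segments∞ : ¬ Eset segments segments∞
  segments≁segments∞ (_ , f) =
    let m , s  = proj₂ segments∞-Lists nothing
        n , s′ = f m
        b , s″ = proj₁ segments-Lists n
    -- If ω were the segment of length `b`, it would lack `b` itself.
    in <-irrefl refl (to (s″ b) (from (s′ b) (from (s b) tt)))

  irreducible : ¬ ComputablyReducible Eset E3
  irreducible (g , g-computable , red) = segments≁segments∞ (from (red segments segments∞) same)
    where
    open Self g g-computable
    decreasing : ∀ k b {x y} → x ≤ y → Agrees k b y → Agrees k b x
    decreasing k b x≤y (t , a) = t , Agree-mono x≤y ≤-refl b (g (self k)) k (g segments) k a

    Close : ℕ → Set
    Close k = FiniteDiff (col (g (self k)) k) (col (g segments) k)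

    close⇒same : ∀ k → Close k → FiniteDiff (col (g segments) k) (col (g segments∞) k)
    close⇒same k (b , f) = FiniteDiff-trans (FiniteDiff-sym (b , f))
      (to (red (self k) segments∞) (Lists⇒Eset
        (Lists-Segment∞ (self-Tagged k) (decreasing k) b
          (from (Agree-⇔ b (g (self k)) k (g segments) k) f)) segments∞-Lists) k)

    close : ∀ k → Close k
    -- Without closeness no offset makes a column of `self k` full, so `self k` lists just the
    -- segments and the reduction returns the closeness denied.
    close k = dne λ ¬close → ¬close
      (to (red (self k) segments) (Lists⇒Eset
        (Lists-Segment (self-Tagged k) (decreasing k) λ b f →
          ¬close (b , to (Agree-⇔ b (g (self k)) k (g segments) k) f)) segments-Lists) k)

    same : E3 (g segments) (g segments∞)
    same k = close⇒same k (close k)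

theorem3p3 : ExcludedMiddle 0ℓ →
    FinitaryReducible Eset E3 × ¬ ComputablyReducible Eset E3
theorem3p3 em = Classical.finitary em , Classical.irreducible em
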